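{- Let $p\geq 5$ be a fixed prime. There is a constant $C_p$ depending only on $p$ such that for any positive integer $n$ and any subset $A\subseteq \mathbb{F}_p^{n}$ which does not contain $p$ distinct elements $x_1,\dots,x_p\in A$ with $x_1+\dots+x_p=0$, we have \[\vert A\vert \leq C_p\cdot \left(\sqrt{\gamma_p\cdot p}\right)^n< C_p\cdot \left(2\sqrt{p}\right)^n.\]
   Context: For a prime $p$, $\gamma_p=\min_{0<t<1}\frac{1+t+\dots+t^{p-1}}{t^{(p-1)/p}}$. -}

module Defs where

open import Data.Nat using (ℕ; zero; suc; _+_; _*_; _∸_; _^_)
open import Data.Nat.Divisibility using (_∣_)
open import Data.Fin using (Fin; toℕ)
open import Data.Vec using (Vec; lookup)
open import Data.List using (List; map; allFin; length)
open import Data.Nat.ListAction using (sum)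
open import Data.Integer using (+_)
open import Data.Rational using (ℚ; _<_; _≤_; 0ℚ; 1ℚ)
import Data.Rational as Q
open import Data.Product using (_×_; ∃)
open import Function.Definitions using (Injective)
open import Relation.Binary.PropositionalEquality using (_≡_)

-- Elements of F_p^n are vectors of length n with entries in Fin p (= Z/pZ).
-- A family x_1..x_p of elements sums to 0 in F_p^n iff each coordinate sum
-- (computed in ℕ via toℕ) is divisible by p.
ZeroSum : (p n : ℕ) → (Fin p → Vec (Fin p) n) → Set
ZeroSum p n x = (j : Fin n) → p ∣ sum (map (λ i → toℕ (lookup (x i) j)) (allFin p))

NoDistinctZeroSum : (p n : ℕ) → List (Vec (Fin p) n) → Set
NoDistinctZeroSum p n A =
  (x : Fin p → Vec (Fin p) n) → Injective _≡_ _≡_ x →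
  ((i : Fin p) → x i ∈ A) → ZeroSum p n x → ⊥
  where
  open import Data.List.Membership.Propositional using (_∈_)
  open import Data.Empty using (⊥)

ℕ→ℚ : ℕ → ℚ
ℕ→ℚ m = (+ m) Q./ 1

_^ℚ_ : ℚ → ℕ → ℚ
t ^ℚ zero = 1ℚ
t ^ℚ suc k = t Q.* (t ^ℚ k)

geom : ℚ → ℕ → ℚ
geom t zero = 0ℚ
geom t (suc k) = 1ℚ Q.+ t Q.* geom t k

-- m ≤ C · (sqrt(γ_p · p))^n, where γ_p = min_{0<t<1} geom t p / t^((p-1)/p).
-- Equivalently (raising to the power 2p, all quantities nonnegative, and using
-- continuity + density of ℚ in (0,1)):
--   for all rational t with 0 < t < 1,
--   m^(2p) · t^(n(p-1)) ≤ C^(2p) · p^(np) · (geom t p)^(np).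
BoundSqrtGammaP : (p C n m : ℕ) → Set
BoundSqrtGammaP p C n m =
  (t : ℚ) → 0ℚ < t → t < 1ℚ →
  ℕ→ℚ (m ^ (2 * p)) Q.* (t ^ℚ (n * (p ∸ 1)))
    ≤ ℕ→ℚ (C ^ (2 * p) * p ^ (n * p)) Q.* (geom t p ^ℚ (n * p))

-- C · (sqrt(γ_p · p))^n < C · (2 sqrt p)^n, i.e. (raising to the power 2p)
-- C^(2p) (γ_p p)^(np) < C^(2p) (4p)^(np); since γ_p is an infimum over t in (0,1)
-- (and the condition is open), this holds iff there is a rational t in (0,1) with
--   C^(2p) · p^(np) · (geom t p)^(np) < C^(2p) · (4p)^(np) · t^(n(p-1)).
SqrtGammaP<2SqrtP : (p C n : ℕ) → Set
SqrtGammaP<2SqrtP p C n =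
  ∃ λ (t : ℚ) → (0ℚ < t) × (t < 1ℚ) ×
    (ℕ→ℚ (C ^ (2 * p) * p ^ (n * p)) Q.* (geom t p ^ℚ (n * p))
      < ℕ→ℚ (C ^ (2 * p) * (4 * p) ^ (n * p)) Q.* (t ^ℚ (n * (p ∸ 1))))

{-# OPTIONS --safe #-}

-- Slice rank. Let B ⊆ F_p^n and let M be the number of monomials of degree ≤ n(p-1)/p with all
-- exponents < p. If every p-tuple in B with sum 0 is constant, then |B| ≤ 2M: otherwise there are
-- functions e, h on B orthogonal to these monomials whose product is supported at a single point s,
-- and one sums h(x₁) e(x₂) ⋯ e(x_p) ∏_j ∏_{a≠0} (x₁ⱼ + ⋯ + x_pⱼ - a) over B^p. Every monomial of
-- the product has low degree in some x_i, so the sum is 0; but only (s, …, s) contributes to it.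
--
-- Making the elements distinct. Only (2p+2) pⁿ pairs of A have a sum with few representations in A,
-- so by Turán A contains a set B, not much smaller than |A|² / pⁿ, in which the sum of any two
-- distinct elements has many. A zero-sum p-tuple in B with no element occurring more than (p+1)/2
-- times can be split into pairs of distinct elements and one leftover, and replacing the pairs by
-- disjoint pairs of A with the same sums makes its elements distinct. For x ∈ B, disjoint multisets
-- of at most (p-1)/2 elements other than x whose differences from x sum to 0 combine with copies of x
-- to such a tuple once there are enough of them; so fewer than p elements T(x) meet all those
-- multisets. Turán again gives B′ ⊆ B, of size at least a constant multiple of |B|, without x ≠ y
-- such that y ∈ T(x); any nonconstant zero-sum p-tuple in B′ has no element occurring more than
-- (p+1)/2 times. Hence |B′| ≤ 2M and |A|² = O(M pⁿ), where Mᵖ t^{n(p-1)} ≤ (1 + ⋯ + t^{p-1})^{np}.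
module Submission where

open import Defs
open import Data.Nat using (ℕ; _≤_; _<_)
open import Data.Nat.Primality using (Prime)
open import Data.Fin using (Fin)
open import Data.Vec using (Vec)
open import Data.List using (List; length)
open import Data.List.Relation.Unary.Unique.Propositional using (Unique)
open import Data.Product using (Σ; _×_)

open import Algebra.Bundles using (CommutativeRing; CommutativeSemiring)
import Algebra.Properties.CommutativeMonoid.Sum as MonoidSum
open import Data.Bool using (if_then_else_; true; false)
open import Data.Fin as Fin using (zero; suc; toℕ; fromℕ<; splitAt; _↑ˡ_; _↑ʳ_)
open import Data.Fin.Properties as Fin using (toℕ<n; toℕ-fromℕ<; all?; ¬∀⟶∃¬)
open import Data.Integer as ℤ using (ℤ; +_)
import Data.Integer.DivMod as ℤ
import Data.Integer.Properties as ℤ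
open import Data.Integer.Divisibility.Signed
open import Data.Integer.Tactic.RingSolver using () renaming (solve-∀ to ℤ-solve-∀)
open import Data.List as List using ([]; _∷_; _++_; allFin; filter; map; cartesianProduct; cartesianProductWith)
import Data.List.Properties as List
open import Data.List.Membership.Propositional using (_∈_; _∉_; find; lose)
open import Data.List.Membership.Propositional.Properties
import Data.List.Membership.DecPropositional as DecMembership
open import Data.List.Relation.Binary.Permutation.Propositional as ↭ using (_↭_; ↭-sym)
open import Data.List.Relation.Binary.Permutation.Propositional.Properties as ↭ using (shift; ∈-resp-↭; ↭-length)
import Data.List.Relation.Binary.Permutation.Setoid.Properties as Permutationₛ
open import Data.List.Relation.Unary.All as All using ([]; _∷_)
open import Data.List.Relation.Unary.AllPairs using ([]; _∷_)
open import Data.List.Relation.Unary.Any as Any using (here; there; any?)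
open import Data.List.Relation.Unary.Any.Properties using (lookup-index)
import Data.List.Relation.Unary.Unique.Propositional.Properties as Unique
open import Data.Nat as ℕ using (zero; suc; _∸_; z≤n; s≤s; NonZero; >-nonZero⁻¹; nonTrivial⇒n>1)
import Data.Nat.Divisibility as ℕ
open import Data.Nat.DivMod as ℕ using (_mod_)
open import Data.Nat.ListAction using (sum)
import Data.Nat.Properties as ℕ
open import Data.Nat.Primality using (euclidsLemma; ¬prime[1]; prime⇒irreducible; prime⇒nonTrivial; prime⇒nonZero)
open import Data.Nat.Tactic.RingSolver using () renaming (solve-∀ to ℕ-solve-∀)
open import Data.Product using (∃; ∃₂; _,_; proj₁; proj₂)
open import Data.Rational as ℚ using (ℚ)
import Data.Rational.Properties as ℚ
import Data.Rational.Unnormalised as ℚᵘ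
import Data.Rational.Unnormalised.Properties as ℚᵘ
open import Data.Sum as Sum using (_⊎_; inj₁; inj₂; [_,_]′)
open import Data.Vec as Vec using ([]; _∷_; lookup; replicate; tabulate)
import Data.Vec.Functional as F
open import Data.Vec.Properties
  using (∷-injective; lookup-replicate; lookup∘tabulate; tabulate∘lookup; tabulate-cong; lookup-zipWith; ≡-dec)
open import Function using (_∘_; const)
open import Relation.Binary.Definitions using (DecidableEquality)
open import Relation.Binary.PropositionalEquality hiding ([_])
open import Relation.Nullary using (¬_; Dec; yes; no; does; contradiction; ¬?; decidable-stable)
open import Relation.Nullary.Decidable using (_×-dec_; _⊎-dec_)

-- Vectors with entries in a list.

private variable
  A B C : Set

vecs : List A → (k : ℕ) → List (Vec A k)
vecs L zero    = [] ∷ []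
vecs L (suc k) = cartesianProductWith _∷_ L (vecs L k)

∈-vecs⁺ : {L : List A} {k : ℕ} (v : Vec A k) → (∀ i → lookup v i ∈ L) → v ∈ vecs L k
∈-vecs⁺ []      h = here refl
∈-vecs⁺ (x ∷ v) h = ∈-cartesianProductWith⁺ _∷_ (h zero) (∈-vecs⁺ v (h ∘ suc))

∈-vecs⁻ : {L : List A} {k : ℕ} (v : Vec A k) → v ∈ vecs L k → ∀ i → lookup v i ∈ L
∈-vecs⁻ {L = L} (x ∷ v) v∈ i with ∈-cartesianProductWith⁻ _∷_ L (vecs L _) v∈
∈-vecs⁻ (x ∷ v) v∈ zero    | _ , _ , a , b , refl = a
∈-vecs⁻ (x ∷ v) v∈ (suc i) | _ , _ , a , b , refl = ∈-vecs⁻ v b i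

vecs-unique : {L : List A} (k : ℕ) → Unique L → Unique (vecs L k)
vecs-unique zero    u = [] ∷ []
vecs-unique (suc k) u = Unique.cartesianProductWith⁺ _∷_ ∷-injective u (vecs-unique k u)

length-cartesianProductWith : (f : A → B → C) (xs : List A) (ys : List B) →
  length (cartesianProductWith f xs ys) ≡ length xs ℕ.* length ys
length-cartesianProductWith f []       ys = refl
length-cartesianProductWith f (x ∷ xs) ys = begin
  length (map (f x) ys ++ rest)              ≡⟨ List.length-++ (map (f x) ys) ⟩
  length (map (f x) ys) ℕ.+ length rest
    ≡⟨ cong₂ ℕ._+_ (List.length-map (f x) ys) (length-cartesianProductWith f xs ys) ⟩
  length ys ℕ.+ length xs ℕ.* length ys      ∎
  where
  open ≡-Reasoning
  rest = cartesianProductWith f xs ys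

length-vecs : (L : List A) (k : ℕ) → length (vecs L k) ≡ length L ℕ.^ k
length-vecs L zero    = refl
length-vecs L (suc k) =
  trans (length-cartesianProductWith _∷_ L (vecs L k)) (cong (length L ℕ.*_) (length-vecs L k))

-- Finite sums over lists in a commutative semiring.

module ListSum {c ℓ} (R : CommutativeSemiring c ℓ) where
  open CommutativeSemiring R hiding (zero) renaming (Carrier to K; refl to ≈-refl; sym to ≈-sym; trans to ≈-trans; setoid to ≈-setoid)
  open import Relation.Binary.Reasoning.Setoid ≈-setoid
  open import Algebra.Properties.CommutativeSemigroup +-commutativeSemigroup using (interchange; x∙yz≈y∙xz)

  open MonoidSum *-commutativeMonoid public using ()
    renaming (sum to ∏; sum-cong-≋ to ∏-cong; ∑-distrib-+ to ∏-distrib-*; ∑-comm to ∏-comm)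

  ∑ : List A → (A → K) → K
  ∑ []       f = 0#
  ∑ (x ∷ xs) f = f x + ∑ xs f

  ∑-cong : (L : List A) {f g : A → K} → (∀ {x} → x ∈ L → f x ≈ g x) → ∑ L f ≈ ∑ L g
  ∑-cong []       h = ≈-refl
  ∑-cong (x ∷ xs) h = +-cong (h (here refl)) (∑-cong xs (h ∘ there))

  ∑-++ : (L M : List A) (f : A → K) → ∑ (L ++ M) f ≈ ∑ L f + ∑ M f
  ∑-++ []      M f = ≈-sym (+-identityˡ _)
  ∑-++ (x ∷ L) M f = ≈-trans (+-congˡ (∑-++ L M f)) (≈-sym (+-assoc _ _ _))

  ∑-zero : (L : List A) → ∑ L (λ _ → 0#) ≈ 0#
  ∑-zero []      = ≈-refl
  ∑-zero (x ∷ L) = ≈-trans (+-identityˡ _) (∑-zero L)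

  ∑-distrib-+ : (L : List A) (f g : A → K) → ∑ L (λ x → f x + g x) ≈ ∑ L f + ∑ L g
  ∑-distrib-+ []      f g = ≈-sym (+-identityˡ _)
  ∑-distrib-+ (x ∷ L) f g = ≈-trans (+-congˡ (∑-distrib-+ L f g)) (interchange _ _ _ _)

  *-distribˡ-∑ : (L : List A) (k : K) (f : A → K) → k * ∑ L f ≈ ∑ L (λ x → k * f x)
  *-distribˡ-∑ []      k f = zeroʳ k
  *-distribˡ-∑ (x ∷ L) k f = ≈-trans (distribˡ k _ _) (+-congˡ (*-distribˡ-∑ L k f))

  *-distribʳ-∑ : (L : List A) (k : K) (f : A → K) → ∑ L f * k ≈ ∑ L (λ x → f x * k)
  *-distribʳ-∑ L k f = begin
    ∑ L f * k             ≈⟨ *-comm _ _ ⟩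
    k * ∑ L f             ≈⟨ *-distribˡ-∑ L k f ⟩
    ∑ L (λ x → k * f x)   ≈⟨ ∑-cong L (λ _ → *-comm _ _) ⟩
    ∑ L (λ x → f x * k)   ∎

  ∑-swap : (L : List A) (M : List B) (f : A → B → K) →
           ∑ L (λ x → ∑ M (f x)) ≈ ∑ M (λ y → ∑ L (λ x → f x y))
  ∑-swap []      M f = ≈-sym (∑-zero M)
  ∑-swap (x ∷ L) M f = ≈-trans (+-congˡ (∑-swap L M f)) (≈-sym (∑-distrib-+ M _ _))

  ∑-map : (h : A → B) (L : List A) (f : B → K) → ∑ (map h L) f ≈ ∑ L (f ∘ h)
  ∑-map h []      f = ≈-refl
  ∑-map h (x ∷ L) f = +-congˡ (∑-map h L f)

  ∑-cartesianProductWith : (h : A → B → C) (L : List A) (M : List B) (f : C → K) →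
    ∑ (cartesianProductWith h L M) f ≈ ∑ L (λ x → ∑ M (λ y → f (h x y)))
  ∑-cartesianProductWith h []      M f = ≈-refl
  ∑-cartesianProductWith h (x ∷ L) M f = ≈-trans (∑-++ (map (h x) M) _ f)
    (+-cong (∑-map (h x) M f) (∑-cartesianProductWith h L M f))

  ∑-↭ : {L M : List A} → L ↭ M → (f : A → K) → ∑ L f ≈ ∑ M f
  ∑-↭ ↭.refl         f = ≈-refl
  ∑-↭ (↭.prep x p)   f = +-congˡ (∑-↭ p f)
  ∑-↭ (↭.swap x y p) f = ≈-trans (x∙yz≈y∙xz _ _ _) (+-congˡ (+-congˡ (∑-↭ p f)))
  ∑-↭ (↭.trans p q)  f = ≈-trans (∑-↭ p f) (∑-↭ q f)

  -- Distributivity, by induction on `k`. It splits sums over tuples into one-variable sums, first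
  -- in the slice rank argument and later for the generating function of the degree.
  ∑-vecs-∏ : (L : List A) (k : ℕ) (g : Fin k → A → K) →
    ∑ (vecs L k) (λ v → ∏ (λ i → g i (lookup v i))) ≈ ∏ (λ i → ∑ L (g i))
  ∑-vecs-∏ L zero    g = +-identityʳ 1#
  ∑-vecs-∏ L (suc k) g = begin
    ∑ (vecs L (suc k)) (λ v → ∏ (λ i → g i (lookup v i)))
      ≈⟨ ∑-cartesianProductWith _∷_ L (vecs L k) _ ⟩
    ∑ L (λ x → ∑ (vecs L k) (λ v → g zero x * ∏ (λ i → g (suc i) (lookup v i))))
      ≈⟨ ∑-cong L (λ {x} _ → *-distribˡ-∑ (vecs L k) (g zero x) _) ⟨
    ∑ L (λ x → g zero x * ∑ (vecs L k) (λ v → ∏ (λ i → g (suc i) (lookup v i))))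
      ≈⟨ ∑-cong L (λ _ → *-congˡ (∑-vecs-∏ L k (g ∘ suc))) ⟩
    ∑ L (λ x → g zero x * ∏ (λ i → ∑ L (g (suc i))))
      ≈⟨ *-distribʳ-∑ L _ (g zero) ⟨
    ∑ L (g zero) * ∏ (λ i → ∑ L (g (suc i)))  ∎

  ∑-partition : {P : A → Set} (P? : ∀ x → Dec (P x)) (L : List A) (f : A → K) →
    ∑ L f ≈ ∑ (filter P? L) f + ∑ (filter (¬? ∘ P?) L) f
  ∑-partition P? []      f = ≈-sym (+-identityˡ _)
  ∑-partition P? (x ∷ L) f with P? x
  ... | yes _ = ≈-trans (+-congˡ (∑-partition P? L f)) (≈-sym (+-assoc _ _ _))
  ... | no  _ = ≈-trans (+-congˡ (∑-partition P? L f)) (x∙yz≈y∙xz _ _ _)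

-- Duplicate-free lists and the pigeonhole principle.

∈⇒↭ : {x : A} {L : List A} → x ∈ L → ∃ λ L′ → L ↭ x ∷ L′
∈⇒↭ {x = x} x∈L with L₁ , L₂ , refl ← ∈-∃++ x∈L = L₁ ++ L₂ , shift x L₁ L₂

Unique-resp-↭ : {L M : List A} → L ↭ M → Unique L → Unique M
Unique-resp-↭ L↭M = Permutationₛ.Unique-resp-↭ (setoid _) (↭.↭⇒↭ₛ L↭M)

tail-∈ : {x y : A} {L : List A} → x ∈ y ∷ L → x ≢ y → x ∈ L
tail-∈ (here x≡y)  x≢y = contradiction x≡y x≢y
tail-∈ (there x∈L) x≢y = x∈L

Unique-⊆⇒length≤ : {L M : List A} → Unique L → (∀ {x} → x ∈ L → x ∈ M) → length L ℕ.≤ length M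
Unique-⊆⇒length≤ {L = []}    u L⊆M = z≤n
Unique-⊆⇒length≤ {L = x ∷ L} (x∉ ∷ u) L⊆M with M′ , M↭ ← ∈⇒↭ (L⊆M (here refl)) =
  subst (suc (length L) ℕ.≤_) (sym (↭-length M↭))
    (s≤s (Unique-⊆⇒length≤ u λ y∈L →
      tail-∈ (∈-resp-↭ M↭ (L⊆M (there y∈L))) (All.lookup x∉ y∈L ∘ sym)))

module _ (_≟_ : DecidableEquality A) where
  open DecMembership _≟_ using (_∈?_)

  length<⇒∃∉ : {L M : List A} → Unique L → length M ℕ.< length L → ∃ λ x → x ∈ L × x ∉ M
  length<⇒∃∉ {L} {M} u M<L with any? (λ x → ¬? (x ∈? M)) L
  ... | yes found = find found
  ... | no none = contradiction (Unique-⊆⇒length≤ u L⊆M) (ℕ.<⇒≱ M<L)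
    where
    L⊆M : ∀ {x} → x ∈ L → x ∈ M
    L⊆M {x} x∈L = decidable-stable (x ∈? M) λ x∉M → none (lose x∈L x∉M)

module ℕSum = ListSum ℕ.+-*-commutativeSemiring
module ℤSum = ListSum ℤ.+-*-commutativeSemiring
module ℚSum = ListSum (CommutativeRing.commutativeSemiring ℚ.+-*-commutativeRing)

-- Linear algebra over F_p, with integers in place of residues.

module ModPrime (p : ℕ) (p-prime : Prime p) where
  open import Data.Integer using (0ℤ; 1ℤ; _+_; _-_; _*_; -_)
  open ℤSum using (∑; ∑-cong; ∑-↭; *-distribˡ-∑; ∑-distrib-+; ∏)

  P : ℤ
  P = + p

  euclid : ∀ {a b} → P ∣ a * b → P ∣ a ⊎ P ∣ b
  euclid {a} {b} d = Sum.map ∣ᵤ⇒∣ ∣ᵤ⇒∣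
    (euclidsLemma ℤ.∣ a ∣ ℤ.∣ b ∣ p-prime (subst (p ℕ.∣_) (ℤ.abs-* a b) (∣⇒∣ᵤ d)))

  P∤1 : ¬ P ∣ 1ℤ
  P∤1 P∣1 = ¬prime[1] (subst Prime (ℕ.∣1⇒≡1 (∣⇒∣ᵤ P∣1)) p-prime)

  ∤-* : ∀ {a b} → ¬ P ∣ a → ¬ P ∣ b → ¬ P ∣ a * b
  ∤-* ∤a ∤b = [ ∤a , ∤b ]′ ∘ euclid

  ∑-∣ : (L : List A) {f : A → ℤ} → (∀ {x} → x ∈ L → P ∣ f x) → P ∣ ∑ L f
  ∑-∣ []      h = divides 0ℤ refl
  ∑-∣ (x ∷ L) h = ∣m∣n⇒∣m+n (h (here refl)) (∑-∣ L (h ∘ there))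

  ∏-∣ : ∀ {k} (f : Fin k → ℤ) i → P ∣ f i → P ∣ ∏ f
  ∏-∣ f zero    d = ∣m⇒∣m*n _ d
  ∏-∣ f (suc i) d = ∣n⇒∣m*n (f zero) (∏-∣ (f ∘ suc) i d)

  ∤-∏ : ∀ {k} (f : Fin k → ℤ) → (∀ i → ¬ P ∣ f i) → ¬ P ∣ ∏ f
  ∤-∏ {zero}  f h = P∤1
  ∤-∏ {suc k} f h = ∤-* (h zero) (∤-∏ (f ∘ suc) (h ∘ suc))

  -- As `L` has no duplicates, splitting off `s` leaves only terms divisible by p.
  ∣∑⇒∣single : {L : List A} {f : A → ℤ} {s : A} → Unique L → s ∈ L →
               (∀ {x} → x ∈ L → x ≢ s → P ∣ f x) → P ∣ ∑ L f → P ∣ f s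
  ∣∑⇒∣single {f = f} {s} u s∈L h P∣∑ with L′ , L↭ ← ∈⇒↭ s∈L =
    ∣m+n∣n⇒∣m (subst (P ∣_) (∑-↭ L↭ f) P∣∑)
      (∑-∣ L′ λ x∈L′ → h (∈-resp-↭ (↭-sym L↭) (there x∈L′)) λ { refl →
        Unique.Unique[x∷xs]⇒x∉xs (Unique-resp-↭ L↭ u) x∈L′ })

  module _ {A : Set} (_≟_ : DecidableEquality A) where

    δ : A → A → ℤ
    δ s x = if does (x ≟ s) then 1ℤ else 0ℤ

    δ-refl : ∀ s → δ s s ≡ 1ℤ
    δ-refl s with s ≟ s
    ... | yes _   = refl
    ... | no s≢s = contradiction refl s≢s

    δ-≢ : ∀ {s x} → x ≢ s → δ s x ≡ 0ℤ
    δ-≢ {s} {x} x≢s with x ≟ s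
    ... | yes x≡s = contradiction x≡s x≢s
    ... | no _    = refl

    _⟂_on_ : (A → ℤ) → (A → ℤ) → List A → Set
    w ⟂ h on B = P ∣ ∑ B (λ x → w x * h x)

    -- Gaussian elimination without division: T collects the pivots, and the scalar k
    -- (a product of pivot entries) replaces the inverses.
    eliminate : ∀ m (w : Fin m → A → ℤ) (B : List A) → Unique B →
      ∃ λ T → length T ℕ.≤ m × (∀ (u : A → ℤ) → ∃₂ λ (h : A → ℤ) k →
        ¬ P ∣ k × (∀ {x} → x ∈ B → x ∉ T → h x ≡ k * u x) × (∀ i → w i ⟂ h on B))
    eliminate zero w B uB = [] , z≤n , λ u → u , 1ℤ , P∤1 , (λ _ _ → sym (ℤ.*-identityˡ _)) , λ ()
    eliminate (suc m) w B uB with any? (λ x → ¬? (P ∣? w zero x)) B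
    -- Here `w zero` vanishes modulo p on `B`; it is orthogonal to every function and gives no
    -- pivot.
    ... | no none with T , |T|≤ , ext ← eliminate m (w ∘ suc) B uB =
      T , ℕ.m≤n⇒m≤1+n |T|≤ , λ u → let h , k , P∤k , h≡ , h⟂ = ext u in
        h , k , P∤k , h≡ , λ
          { zero    → ∑-∣ B λ {x} x∈B → ∣m⇒∣m*n (h x) (decidable-stable (P ∣? w zero x) λ ∤ → none (lose x∈B ∤))
          ; (suc i) → h⟂ i }
    ... | yes pivot with s , s∈B , P∤a ← find pivot with B′ , B↭ ← ∈⇒↭ s∈B
      with s∉B′ ∷ uB′ ← Unique-resp-↭ B↭ uB
      -- Cross-multiplying with the pivot row cancels the values at `s`, so the remaining rows can
      -- be treated on `B′`.
      with T , |T|≤ , ext ← eliminate m (λ i x → w zero s * w (suc i) x - w (suc i) s * w zero x) B′ uB′ =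
      s ∷ T , s≤s |T|≤ , extend
      where
      a = w zero s

      extend : ∀ u → ∃₂ λ h k → ¬ P ∣ k × (∀ {x} → x ∈ B → x ∉ s ∷ T → h x ≡ k * u x) × (∀ i → w i ⟂ h on B)
      extend u with h′ , k , P∤k , h′≡ , h′⟂ ← ext u = h , a * k , ∤-* P∤a P∤k , h≡ , h⟂
        where
        -- Off `s` the function is `a * h′`, so its sum against `w zero` is a r plus a times the sum
        -- over `B′`; this value of `r` makes it 0.
        r = - ∑ B′ (λ x → w zero x * h′ x)

        h : A → ℤ
        h x = if does (x ≟ s) then r else a * h′ x

        h-s : h s ≡ r
        h-s with s ≟ s
        ... | yes _   = refl
        ... | no s≢s = contradiction refl s≢s

        h-≢ : ∀ {x} → x ≢ s → h x ≡ a * h′ x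
        h-≢ {x} x≢s with x ≟ s
        ... | yes x≡s = contradiction x≡s x≢s
        ... | no _    = refl

        h≡ : ∀ {x} → x ∈ B → x ∉ s ∷ T → h x ≡ a * k * u x
        h≡ {x} x∈B x∉ = begin
          h x             ≡⟨ h-≢ x≢s ⟩
          a * h′ x        ≡⟨ cong (a *_) (h′≡ (tail-∈ (∈-resp-↭ B↭ x∈B) x≢s) (x∉ ∘ there)) ⟩
          a * (k * u x)   ≡⟨ ℤ.*-assoc a k (u x) ⟨
          a * k * u x     ∎
          where
          open ≡-Reasoning
          x≢s = x∉ ∘ here

        expand : ∀ v → ∑ B (λ x → v x * h x) ≡ v s * r + a * ∑ B′ (λ x → v x * h′ x)
        expand v = begin
          ∑ B (λ x → v x * h x)                          ≡⟨ ∑-↭ B↭ _ ⟩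
          v s * h s + ∑ B′ (λ x → v x * h x)             ≡⟨ cong₂ _+_ (cong (v s *_) h-s) (∑-cong B′ λ {x} x∈ →
                                                             trans (cong (v x *_) (h-≢ (All.lookup s∉B′ x∈ ∘ sym))) (lemma (v x) a (h′ x))) ⟩
          v s * r + ∑ B′ (λ x → a * (v x * h′ x))        ≡⟨ cong (λ y → v s * r + y) (*-distribˡ-∑ B′ a _) ⟨
          v s * r + a * ∑ B′ (λ x → v x * h′ x)          ∎
          where
          open ≡-Reasoning
          lemma : ∀ x y z → x * (y * z) ≡ y * (x * z)
          lemma = ℤ-solve-∀

        h⟂ : ∀ i → w i ⟂ h on B
        h⟂ zero = divides 0ℤ (trans (expand (w zero)) (lemma a _))
          where
          lemma : ∀ x y → x * - y + x * y ≡ 0ℤ * P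
          lemma x y = trans (lemma′ x y) (sym (ℤ.*-zeroˡ P))
            where
            lemma′ : ∀ x y → x * - y + x * y ≡ 0ℤ
            lemma′ = ℤ-solve-∀
        h⟂ (suc i) = subst (P ∣_) (sym eq) (h′⟂ i)
          where
          open ≡-Reasoning
          b = w (suc i) s
          S₀ = ∑ B′ (λ x → w zero x * h′ x)
          S₁ = ∑ B′ (λ x → w (suc i) x * h′ x)
          lemma : ∀ x y z → x * - y + z ≡ z + - x * y
          lemma = ℤ-solve-∀
          lemma₂ : ∀ a b x y z → a * (x * z) + - b * (y * z) ≡ (a * x - b * y) * z
          lemma₂ = ℤ-solve-∀
          eq : ∑ B (λ x → w (suc i) x * h x) ≡ ∑ B′ (λ x → (a * w (suc i) x - b * w zero x) * h′ x)
          eq = begin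
            ∑ B (λ x → w (suc i) x * h x)    ≡⟨ expand (w (suc i)) ⟩
            b * - S₀ + a * S₁                ≡⟨ lemma b S₀ (a * S₁) ⟩
            a * S₁ + - b * S₀                ≡⟨ cong₂ _+_ (*-distribˡ-∑ B′ a _) (*-distribˡ-∑ B′ (- b) _) ⟩
            ∑ B′ (λ x → a * (w (suc i) x * h′ x)) + ∑ B′ (λ x → - b * (w zero x * h′ x))
                                             ≡⟨ ∑-distrib-+ B′ _ _ ⟨
            ∑ B′ (λ x → a * (w (suc i) x * h′ x) + - b * (w zero x * h′ x))
                                             ≡⟨ ∑-cong B′ (λ {x} _ → lemma₂ a b (w (suc i) x) (w zero x) (h′ x)) ⟩
            ∑ B′ (λ x → (a * w (suc i) x - b * w zero x) * h′ x)  ∎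

    -- The first elimination gives pivots `T`. The second, with the indicators of the points of `T`
    -- added to `w`, gives at most 2m pivots `T₂`, and `s` is chosen outside them. So some `h`
    -- orthogonal to `w` vanishes on `T` but not at `s`. Hence `s` is not in `T`, and `δ s` extends
    -- to an orthogonal `e` which on `B` lives on `T` and `s` only; there `h` kills it except at
    -- `s`.
    dual-pair : ∀ m (w : Fin m → A → ℤ) (B : List A) → Unique B → m ℕ.+ m ℕ.< length B →
      ∃ λ s → s ∈ B × ∃₂ λ (e h : A → ℤ) →
        ¬ P ∣ e s × ¬ P ∣ h s × (∀ {x} → x ∈ B → x ≢ s → P ∣ e x * h x) ×
        (∀ i → w i ⟂ e on B) × (∀ i → w i ⟂ h on B)
    dual-pair m w B uB 2m<|B|
      with T , |T|≤m , ext ← eliminate m w B uB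
      with T₂ , |T₂|≤ , ext₂ ← eliminate (m ℕ.+ length T) (λ i → [ w , δ ∘ List.lookup T ]′ (splitAt m i)) B uB
      with s , s∈B , s∉T₂ ← length<⇒∃∉ _≟_ {M = T₂} uB (ℕ.≤-<-trans (ℕ.≤-trans |T₂|≤ (ℕ.+-monoʳ-≤ m |T|≤m)) 2m<|B|)
      with h , k , P∤k , h≡ , h⟂ ← ext₂ (const 1ℤ)
      with e , k′ , P∤k′ , e≡ , e⟂ ← ext (δ s) =
      s , s∈B , e , h , P∤e , P∤h , vanish , e⟂ ,
      λ i → subst (_⟂ h on B) (cong [ w , δ ∘ List.lookup T ]′ (Fin.splitAt-↑ˡ m i _)) (h⟂ (i ↑ˡ _))
      where
      P∤h : ¬ P ∣ h s
      P∤h = P∤k ∘ subst (P ∣_) (trans (h≡ s∈B s∉T₂) (ℤ.*-identityʳ k))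

      -- Orthogonality to the indicator of `t` isolates the value of `h` at `t`.
      h-T : ∀ {t} → t ∈ B → t ∈ T → P ∣ h t
      h-T {t} t∈B t∈T = subst (P ∣_) (trans (cong (_* h t) (δ-refl t)) (ℤ.*-identityˡ _))
        (∣∑⇒∣single uB t∈B (λ {x} _ x≢t → divides 0ℤ (cong (_* h x) (δ-≢ x≢t)))
          (subst (_⟂ h on B)
            (trans (cong [ w , δ ∘ List.lookup T ]′ (Fin.splitAt-↑ʳ m _ (Any.index t∈T)))
                   (cong δ (sym (lookup-index t∈T))))
            (h⟂ (m ↑ʳ Any.index t∈T))))

      P∤e : ¬ P ∣ e s
      P∤e = P∤k′ ∘ subst (P ∣_) (trans (e≡ s∈B (P∤h ∘ h-T s∈B)) (trans (cong (k′ *_) (δ-refl s)) (ℤ.*-identityʳ k′)))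

      open DecMembership _≟_ using (_∈?_)

      vanish : ∀ {x} → x ∈ B → x ≢ s → P ∣ e x * h x
      vanish {x} x∈B x≢s with x ∈? T
      ... | yes x∈T = ∣n⇒∣m*n (e x) (h-T x∈B x∈T)
      ... | no  x∉T = ∣m⇒∣m*n (h x) (divides 0ℤ (trans (e≡ x∈B x∉T) (trans (cong (k′ *_) (δ-≢ x≢s)) (ℤ.*-zeroʳ k′))))

-- Sums of exponents.

module ℕFinSum = MonoidSum ℕ.+-0-commutativeMonoid
open ℕFinSum using () renaming (sum to sumFin)

sumFin-bump : ∀ {k} (e : Fin k → ℕ) i → sumFin (F.updateAt e i suc) ≡ suc (sumFin e)
sumFin-bump e zero    = refl
sumFin-bump e (suc i) = trans (cong (e zero ℕ.+_) (sumFin-bump (e ∘ suc) i)) (ℕ.+-suc _ _)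

sumFin-≤ : ∀ {k} (e : Fin k → ℕ) {b} → (∀ i → e i ℕ.≤ b) → sumFin e ℕ.≤ k ℕ.* b
sumFin-≤ {zero}  e h = z≤n
sumFin-≤ {suc k} e h = ℕ.+-mono-≤ (h zero) (sumFin-≤ (e ∘ suc) (h ∘ suc))

≤-sumFin : ∀ {k} (e : Fin k → ℕ) i → e i ℕ.≤ sumFin e
≤-sumFin e zero    = ℕ.m≤m+n _ _
≤-sumFin e (suc i) = ℕ.≤-trans (≤-sumFin (e ∘ suc) i) (ℕ.m≤n+m _ (e zero))

∃≤average : ∀ {k} .{{_ : NonZero k}} (a : Fin k → ℕ) → ∃ λ i → k ℕ.* a i ℕ.≤ sumFin a
∃≤average {suc zero}    a = zero , ℕ.≤-refl
∃≤average {suc (suc k)} a with i , a-i≤ ← ∃≤average (a ∘ suc) with ℕ.≤-total (a zero) (a (suc i))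
... | inj₁ a₀≤ = zero , ℕ.+-monoʳ-≤ (a zero) (ℕ.≤-trans (ℕ.*-monoʳ-≤ (suc k) a₀≤) a-i≤)
... | inj₂ ≤a₀ = suc i , ℕ.+-mono-≤ ≤a₀ a-i≤

-- The slice rank bound.

module SliceBound (p : ℕ) (p-prime : Prime p) where
  open ModPrime p p-prime
  open import Data.Integer using (0ℤ; 1ℤ; _+_; _-_; _*_; -_; _^_)
  open ℤSum

  sumOver : ∀ {k} → (A → ℤ) → Vec A k → ℤ
  sumOver {k = k} c v = ∑ (allFin k) (λ i → c (lookup v i))

  powers : ∀ {k} → (A → ℤ) → (Fin k → ℕ) → Vec A k → ℤ
  powers c e v = ∏ (λ i → c (lookup v i) ^ e i)

  -- With as = 1, …, p - 1 this plays the role of 1 - (sumOver c v)^(p-1); only its zeros mod p matter,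
  -- so Fermat's little theorem is not needed.
  shifts : ∀ {k} → (A → ℤ) → List ℤ → Vec A k → ℤ
  shifts c []       v = 1ℤ
  shifts c (a ∷ as) v = (sumOver c v - a) * shifts c as v

  ∏-bump : ∀ {k} (f : Fin k → ℤ) (e : Fin k → ℕ) i →
           ∏ (λ j → f j ^ F.updateAt e i suc j) ≡ ∏ (λ j → f j ^ e j) * f i
  ∏-bump f e zero    = lemma (f zero) _ _
    where
    lemma : ∀ x y z → x * y * z ≡ y * z * x
    lemma = ℤ-solve-∀
  ∏-bump f e (suc i) = trans (cong (f zero ^ e zero *_) (∏-bump (f ∘ suc) (e ∘ suc) i)) (sym (ℤ.*-assoc (f zero ^ e zero) _ _))

  powers-sumOver : ∀ {k} (c : A → ℤ) (e : Fin k → ℕ) (v : Vec A k) →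
    powers c e v * sumOver c v ≡ ∑ (allFin k) (λ i → powers c (F.updateAt e i suc) v)
  powers-sumOver {k = k} c e v = trans (*-distribˡ-∑ (allFin k) (powers c e v) _)
    (∑-cong (allFin k) (λ {i} _ → sym (∏-bump (λ j → c (lookup v j)) e i)))

  powers-0 : ∀ {k} (f : Fin k → ℤ) → ∏ (λ j → f j ^ 0) ≡ 1ℤ
  powers-0 {zero}  f = refl
  powers-0 {suc k} f = trans (ℤ.*-identityˡ _) (powers-0 (f ∘ suc))

  module _ {A : Set} {k : ℕ} (V : List (Vec A k)) where

    -- Multiplying out one factor `sumOver c v - a` either raises one exponent by 1 or contributes
    -- the scalar `- a`, so every monomial that arises has degree at most `sumFin e + length as`.
    -- The weight `H` is carried along for the other coordinates.
    expand-shifts : (c : A → ℤ) (as : List ℤ) (H : Vec A k → ℤ) (e : Fin k → ℕ) →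
      (∀ e′ → sumFin e′ ℕ.≤ sumFin e ℕ.+ length as → P ∣ ∑ V (λ v → H v * powers c e′ v)) →
      P ∣ ∑ V (λ v → H v * (powers c e v * shifts c as v))
    expand-shifts c [] H e h = subst (P ∣_)
      (∑-cong V (λ {v} _ → cong (H v *_) (sym (ℤ.*-identityʳ _))))
      (h e (ℕ.m≤m+n _ 0))
    expand-shifts c (a ∷ as) H e h = subst (P ∣_) (sym split) (∣m∣n⇒∣m+n
      (∑-∣ (allFin k) λ {i} _ → expand-shifts c as H (bump i) λ e′ e′≤ →
        h e′ (subst (sumFin e′ ℕ.≤_) (trans (cong (ℕ._+ length as) (sumFin-bump e i)) (sym (ℕ.+-suc _ _))) e′≤))
      (∣n⇒∣m*n (- a) (expand-shifts c as H e λ e′ e′≤ → h e′ (ℕ.≤-trans e′≤ (ℕ.+-monoʳ-≤ (sumFin e) (ℕ.n≤1+n _))))))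
      where
      bump = λ i → F.updateAt e i suc
      L = shifts c as

      rearrange : ∀ H e s a L → H * (e * ((s - a) * L)) ≡ e * s * (H * L) + - a * (H * (e * L))
      rearrange = ℤ-solve-∀
      rearrange′ : ∀ e H L → e * (H * L) ≡ H * (e * L)
      rearrange′ = ℤ-solve-∀

      open ≡-Reasoning
      split : ∑ V (λ v → H v * (powers c e v * shifts c (a ∷ as) v))
            ≡ ∑ (allFin k) (λ i → ∑ V (λ v → H v * (powers c (bump i) v * L v)))
              + - a * ∑ V (λ v → H v * (powers c e v * L v))
      split = begin
        ∑ V (λ v → H v * (powers c e v * shifts c (a ∷ as) v))
          ≡⟨ ∑-cong V (λ {v} _ → trans (rearrange (H v) (powers c e v) (sumOver c v) a (L v))
               (cong (λ y → y * (H v * L v) + - a * (H v * (powers c e v * L v))) (powers-sumOver c e v))) ⟩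
        ∑ V (λ v → ∑ (allFin k) (λ i → powers c (bump i) v) * (H v * L v) + - a * (H v * (powers c e v * L v)))
          ≡⟨ ∑-distrib-+ V _ _ ⟩
        ∑ V (λ v → ∑ (allFin k) (λ i → powers c (bump i) v) * (H v * L v)) + ∑ V (λ v → - a * (H v * (powers c e v * L v)))
          ≡⟨ cong₂ _+_ (∑-cong V (λ {v} _ → trans (*-distribʳ-∑ (allFin k) (H v * L v) _)
               (∑-cong (allFin k) (λ {i} _ → rearrange′ (powers c (bump i) v) (H v) (L v))))) (sym (*-distribˡ-∑ V (- a) _)) ⟩
        ∑ V (λ v → ∑ (allFin k) (λ i → H v * (powers c (bump i) v * L v))) + - a * ∑ V (λ v → H v * (powers c e v * L v))
          ≡⟨ cong (λ y → y + - a * ∑ V (λ v → H v * (powers c e v * L v))) (∑-swap V (allFin k) _) ⟩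
        ∑ (allFin k) (λ i → ∑ V (λ v → H v * (powers c (bump i) v * L v))) + - a * ∑ V (λ v → H v * (powers c e v * L v)) ∎

    -- One coordinate at a time: the factors of the later coordinates sit in the weight while
    -- coordinate `zero` is expanded from exponents 0, and the powers so obtained join the weight
    -- for the recursion.
    expand-∏-shifts : ∀ {n} (c : Fin n → A → ℤ) (as : List ℤ) (H : Vec A k → ℤ) →
      (∀ (E : Fin n → Fin k → ℕ) → (∀ j → sumFin (E j) ℕ.≤ length as) →
        P ∣ ∑ V (λ v → H v * ∏ (λ j → powers (c j) (E j) v))) →
      P ∣ ∑ V (λ v → H v * ∏ (λ j → shifts (c j) as v))
    expand-∏-shifts {zero}  c as H h = h (λ ()) (λ ())
    expand-∏-shifts {suc n} c as H h = subst (P ∣_) (∑-cong V λ {v} _ → reorder v)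
      (expand-shifts (c zero) as (λ v → H v * ∏ (λ j → shifts (c (suc j)) as v)) (λ _ → 0) λ e e≤ →
        subst (P ∣_) (∑-cong V λ {v} _ → rearrange (H v) (powers (c zero) e v) _)
          (expand-∏-shifts (c ∘ suc) as (λ v → H v * powers (c zero) e v) λ E E≤ →
            subst (P ∣_) (∑-cong V λ {v} _ → sym (ℤ.*-assoc (H v) (powers (c zero) e v) _))
              (h (e F.∷ E) λ { zero → subst (λ y → sumFin e ℕ.≤ y ℕ.+ length as) (sumFin-0 k) e≤ ; (suc j) → E≤ j })))
      where
      sumFin-0 : ∀ k → sumFin {k} (λ _ → 0) ≡ 0
      sumFin-0 zero    = refl
      sumFin-0 (suc k) = sumFin-0 k

      rearrange : ∀ x y z → x * y * z ≡ x * z * y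
      rearrange = ℤ-solve-∀
      rearrange′ : ∀ x y z → x * y * (1ℤ * z) ≡ x * (z * y)
      rearrange′ = ℤ-solve-∀

      reorder : ∀ v → H v * ∏ (λ j → shifts (c (suc j)) as v) * (powers (c zero) (λ _ → 0) v * shifts (c zero) as v)
                    ≡ H v * ∏ (λ j → shifts (c j) as v)
      reorder v = trans
        (cong (λ y → H v * ∏ (λ j → shifts (c (suc j)) as v) * (y * shifts (c zero) as v)) (powers-0 (λ i → c zero (lookup v i))))
        (rearrange′ (H v) _ (shifts (c zero) as v))

  instance
    p-nonZero : NonZero p
    p-nonZero = prime⇒nonZero p-prime

  1<p : 1 ℕ.< p
  1<p = nonTrivial⇒n>1 p {{prime⇒nonTrivial p-prime}}

  i₀ i₁ : Fin p
  i₀ = fromℕ< (>-nonZero⁻¹ p)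
  i₁ = fromℕ< 1<p

  i₁≢i₀ : i₁ ≢ i₀
  i₁≢i₀ eq = contradiction (trans (sym (toℕ-fromℕ< 1<p)) (trans (cong toℕ eq) (toℕ-fromℕ< (>-nonZero⁻¹ p)))) λ ()

  monomial : ∀ {n} → (Fin n → A → ℤ) → (Fin n → ℕ) → A → ℤ
  monomial c ε x = ∏ (λ j → c j x ^ ε j)

  degree : ∀ {n} → Vec (Fin p) n → ℕ
  degree ε = sumFin (toℕ ∘ lookup ε)

  -- Degree at most n(p-1)/p, with the inequality multiplied by p to stay in ℕ.
  lowExponents : ∀ n → List (Vec (Fin p) n)
  lowExponents n = filter (λ ε → p ℕ.* degree ε ℕ.≤? n ℕ.* (p ∸ 1)) (vecs (allFin p) n)

  ∈-lowExponents : ∀ {n} (e : Fin n → ℕ) → (∀ j → e j ℕ.< p) → p ℕ.* sumFin e ℕ.≤ n ℕ.* (p ∸ 1) →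
    ∃ λ ε → ε ∈ lowExponents n × (∀ j → toℕ (lookup ε j) ≡ e j)
  ∈-lowExponents {n} e e<p low =
    ε , ∈-filter⁺ _ (∈-vecs⁺ ε (λ _ → ∈-allFin _)) (subst (λ s → p ℕ.* s ℕ.≤ n ℕ.* (p ∸ 1)) (sym deg) low) , toℕ-ε
    where
    ε = tabulate (λ j → fromℕ< (e<p j))
    toℕ-ε : ∀ j → toℕ (lookup ε j) ≡ e j
    toℕ-ε j = trans (cong toℕ (lookup∘tabulate (λ j → fromℕ< (e<p j)) j)) (toℕ-fromℕ< (e<p j))
    deg : degree ε ≡ sumFin e
    deg = ℕFinSum.sum-cong-≗ toℕ-ε

  module _ {A : Set} {n : ℕ} (c : Fin n → A → ℤ) (B : List A) where

    -- After expansion each monomial gives a product over the p slots of sums over `B`. Its total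
    -- degree is at most n(p-1), so by averaging some slot has degree at most n(p-1)/p, and the sum
    -- in that slot is divisible by p.
    slices-vanish : (f : Fin p → A → ℤ) (as : List ℤ) → length as ≡ p ∸ 1 →
      (∀ i {ε} → ε ∈ lowExponents n → P ∣ ∑ B (λ x → monomial c (toℕ ∘ lookup ε) x * f i x)) →
      P ∣ ∑ (vecs B p) (λ v → ∏ (λ i → f i (lookup v i)) * ∏ (λ j → shifts (c j) as v))
    slices-vanish f as |as| ⟂low = expand-∏-shifts (vecs B p) c as (λ v → ∏ (λ i → f i (lookup v i))) vanish
      where
      module _ (E : Fin n → Fin p → ℕ) (E≤ : ∀ j → sumFin (E j) ℕ.≤ length as) where
        g : Fin p → A → ℤ
        g i x = f i x * monomial c (λ j → E j i) x

        factor : ∑ (vecs B p) (λ v → ∏ (λ i → f i (lookup v i)) * ∏ (λ j → powers (c j) (E j) v)) ≡ ∏ (λ i → ∑ B (g i))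
        factor = trans
          (∑-cong (vecs B p) λ {v} _ → trans
            (cong (∏ (λ i → f i (lookup v i)) *_) (∏-comm (λ j i → c j (lookup v i) ^ E j i)))
            (sym (∏-distrib-* (λ i → f i (lookup v i)) (λ i → monomial c (λ j → E j i) (lookup v i)))))
          (∑-vecs-∏ B p g)

        open ℕ.≤-Reasoning

        low-factor : ∃ λ i → p ℕ.* sumFin (λ j → E j i) ℕ.≤ n ℕ.* (p ∸ 1)
        low-factor with i , i≤ ← ∃≤average (λ i → sumFin (λ j → E j i)) = i , (begin
          p ℕ.* sumFin (λ j → E j i)         ≤⟨ i≤ ⟩
          sumFin (λ i → sumFin (λ j → E j i)) ≡⟨ ℕFinSum.∑-comm (λ i j → E j i) ⟩
          sumFin (λ j → sumFin (E j))         ≤⟨ sumFin-≤ _ E≤ ⟩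
          n ℕ.* length as                    ≡⟨ cong (n ℕ.*_) |as| ⟩
          n ℕ.* (p ∸ 1)                      ∎)
        -- Each coordinate contributes degree at most p - 1, so the exponents fit into `Fin p`.
        E< : ∀ i j → E j i ℕ.< p
        E< i j = begin-strict
          E j i              ≤⟨ ≤-sumFin (E j) i ⟩
          sumFin (E j)       ≤⟨ E≤ j ⟩
          length as          ≡⟨ |as| ⟩
          p ∸ 1              <⟨ ℕ.∸-monoʳ-< {p} {1} {0} (s≤s z≤n) (>-nonZero⁻¹ p) ⟩
          p                  ∎

        vanish : P ∣ ∑ (vecs B p) (λ v → ∏ (λ i → f i (lookup v i)) * ∏ (λ j → powers (c j) (E j) v))
        vanish with i , i≤ ← low-factor with ε , ε∈ , toℕ-ε ← ∈-lowExponents (λ j → E j i) (E< i) i≤ =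
          subst (P ∣_) (sym factor) (∏-∣ (λ i → ∑ B (g i)) i (subst (P ∣_)
            (∑-cong B λ {x} _ → trans
              (cong (_* f i x) (∏-cong λ j → cong (c j x ^_) (toℕ-ε j)))
              (ℤ.*-comm _ (f i x)))
            (⟂low i ε∈)))

  ∑-const : (L : List A) (a : ℤ) → ∑ L (λ _ → a) ≡ + length L * a
  ∑-const []      a = sym (ℤ.*-zeroˡ a)
  ∑-const (x ∷ L) a = trans (cong (λ y → a + y) (∑-const L a)) (sym (ℤ.suc-* (+ length L) a))

  sumOver-replicate : (c : A → ℤ) (x : A) → P ∣ sumOver c (replicate p x)
  sumOver-replicate c x = subst (P ∣_) (sym eq) (∣m⇒∣m*n (c x) (divides 1ℤ (sym (ℤ.*-identityˡ P))))
    where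
    eq : sumOver c (replicate p x) ≡ P * c x
    eq = trans (∑-cong (allFin p) λ {i} _ → cong c (lookup-replicate i x))
        (trans (∑-const (allFin p) (c x)) (cong (λ m → + m * c x) (List.length-tabulate {n = p} (λ i → i))))

  nonzeroResidues : List ℤ
  nonzeroResidues = map (λ i → + suc (toℕ i)) (allFin (p ∸ 1))

  p≡1+[p∸1] : p ≡ suc (p ∸ 1)
  p≡1+[p∸1] = sym (ℕ.suc-pred p)

  ∤-nonzeroResidue : ∀ {a} → a ∈ nonzeroResidues → ¬ P ∣ a
  ∤-nonzeroResidue a∈ P∣a with i , _ , refl ← ∈-map⁻ _ a∈ =
    ℕ.<⇒≱ (s≤s (toℕ<n i)) (subst (ℕ._≤ suc (toℕ i)) p≡1+[p∸1] (ℕ.∣⇒≤ (∣⇒∣ᵤ P∣a)))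

  -- The witness is the remainder of `s` modulo p.
  ∃nonzeroResidue : ∀ {s} → ¬ P ∣ s → ∃ λ a → a ∈ nonzeroResidues × P ∣ s - a
  ∃nonzeroResidue {s} P∤s with s ℤ.%ℕ p in eq
  ... | zero  = contradiction
    (divides (s ℤ./ℕ p) (trans (ℤ.a≡a%ℕn+[a/ℕn]*n s p) (trans (cong (λ r → + r + (s ℤ./ℕ p) * P) eq) (ℤ.+-identityˡ _)))) P∤s
  ... | suc r = + suc r , r∈ , divides (s ℤ./ℕ p)
    (trans (cong (_- + suc r) (trans (ℤ.a≡a%ℕn+[a/ℕn]*n s p) (cong (λ r → + r + (s ℤ./ℕ p) * P) eq))) (cancel (+ suc r) _))
    where
    cancel : ∀ x y → x + y - x ≡ y
    cancel = ℤ-solve-∀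
    r<p-1 : r ℕ.< p ∸ 1
    r<p-1 = ℕ.s≤s⁻¹ (subst₂ ℕ._<_ eq p≡1+[p∸1] (ℤ.n%ℕd<d s p))
    r∈ : + suc r ∈ nonzeroResidues
    r∈ = subst (λ m → + suc m ∈ nonzeroResidues) (toℕ-fromℕ< r<p-1) (∈-map⁺ _ (∈-allFin (fromℕ< r<p-1)))

  shifts-∣ : ∀ {k a} (c : A → ℤ) {as} (v : Vec A k) → a ∈ as → P ∣ sumOver c v - a → P ∣ shifts c as v
  shifts-∣ c v (here refl)          d = ∣m⇒∣m*n _ d
  shifts-∣ c {a′ ∷ as} v (there a∈) d = ∣n⇒∣m*n (sumOver c v - a′) (shifts-∣ c v a∈ d)

  -- Modulo p each factor is `- a` with `a` nonzero, and p is prime.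
  shifts-∤ : ∀ {k} (c : A → ℤ) as (v : Vec A k) → (∀ {a} → a ∈ as → ¬ P ∣ a) → P ∣ sumOver c v → ¬ P ∣ shifts c as v
  shifts-∤ c []       v ∤as d = P∤1
  shifts-∤ c (a ∷ as) v ∤as d = ∤-* (λ d′ → ∤as (here refl) (subst (P ∣_) (cancel (sumOver c v) a) (∣m∣n⇒∣m-n d d′)))
    (shifts-∤ c as v (∤as ∘ there) d)
    where
    cancel : ∀ s a → s - (s - a) ≡ a
    cancel = ℤ-solve-∀

  module _ {A : Set} (_≟_ : DecidableEquality A) {n : ℕ} (c : Fin n → A → ℤ) where

    ZeroSumTuple : Vec A p → Set
    ZeroSumTuple v = ∀ j → P ∣ sumOver (c j) v

    zeroSum? : ∀ v → Dec (ZeroSumTuple v)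
    zeroSum? v = all? (λ j → P ∣? sumOver (c j) v)

    slice-bound : (B : List A) → Unique B → length (lowExponents n) ℕ.+ length (lowExponents n) ℕ.< length B →
      ∃ λ v → (∀ i → lookup v i ∈ B) × ZeroSumTuple v × (∀ x → v ≢ replicate p x)
    slice-bound B uB 2M<|B| with any? (λ v → zeroSum? v ×-dec ¬? (≡-dec _≟_ v (replicate p (lookup v i₀)))) (vecs B p)
    ... | yes found with v , v∈ , zs , v≢ ← find found =
      v , ∈-vecs⁻ v v∈ , zs , λ x v≡ → v≢ (trans v≡ (cong (replicate p) (sym (trans (cong (λ v → lookup v i₀) v≡) (lookup-replicate i₀ x)))))
    ... | no none
      with s , s∈B , e , h , P∤e , P∤h , vanish , e⟂ , h⟂ ←
           dual-pair _≟_ (length (lowExponents n)) (λ i → monomial c (toℕ ∘ lookup (List.lookup (lowExponents n) i))) B uB 2M<|B| =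
      contradiction P∣T-s P∤T-s
      where
      -- One slot carries `h`, the other p - 1 carry `e`; both occur since p > 1.
      f : Fin p → A → ℤ
      f i = if does (i Fin.≟ i₀) then h else e

      f-i₀ : f i₀ ≡ h
      f-i₀ with i₀ Fin.≟ i₀
      ... | yes _ = refl
      ... | no ≢  = contradiction refl ≢

      f-i₁ : f i₁ ≡ e
      f-i₁ with i₁ Fin.≟ i₀
      ... | yes eq = contradiction eq i₁≢i₀
      ... | no _   = refl

      f-case : ∀ (Q : (A → ℤ) → Set) → Q h → Q e → ∀ i → Q (f i)
      f-case Q qh qe i with does (i Fin.≟ i₀)
      ... | true  = qh
      ... | false = qe

      T : Vec A p → ℤ
      T v = ∏ (λ i → f i (lookup v i)) * ∏ (λ j → shifts (c j) nonzeroResidues v)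

      P∣∑T : P ∣ ∑ (vecs B p) T
      P∣∑T = slices-vanish c B f nonzeroResidues
        (trans (List.length-map _ (allFin (p ∸ 1))) (List.length-tabulate {n = p ∸ 1} (λ i → i)))
        λ i {ε} ε∈ → f-case (λ g → P ∣ ∑ B (λ x → monomial c (toℕ ∘ lookup ε) x * g x)) (low h h⟂ ε∈) (low e e⟂ ε∈) i
        where
        low : ∀ g → (∀ i → _⟂_on_ _≟_ (monomial c (toℕ ∘ lookup (List.lookup (lowExponents n) i))) g B) →
              ∀ {ε} → ε ∈ lowExponents n → P ∣ ∑ B (λ x → monomial c (toℕ ∘ lookup ε) x * g x)
        low g g⟂ {ε} ε∈ = subst (λ ε → P ∣ ∑ B (λ x → monomial c (toℕ ∘ lookup ε) x * g x))
          (sym (lookup-index ε∈)) (g⟂ (Any.index ε∈))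

      P∣T : ∀ {v} → v ∈ vecs B p → v ≢ replicate p s → P ∣ T v
      P∣T {v} v∈ v≢s with all? (λ j → P ∣? sumOver (c j) v)
      -- Some coordinate sum is congruent to a nonzero residue, so one of its shifts vanishes.
      ... | no ¬zs with j , P∤ ← ¬∀⟶∃¬ n _ (λ j → P ∣? sumOver (c j) v) ¬zs
        with a , a∈ , d ← ∃nonzeroResidue P∤ =
        ∣n⇒∣m*n (∏ (λ i → f i (lookup v i))) (∏-∣ (λ j → shifts (c j) nonzeroResidues v) j (shifts-∣ (c j) v a∈ d))
      -- By `none` the tuple is constant, with a value `x` other than `s`. As p divides `e x * h x`,
      -- it divides the factor in slot `i₁` or in slot `i₀`.
      ... | yes zs = ∣m⇒∣m*n _ ([ at i₁ f-i₁ , at i₀ f-i₀ ]′ (euclid (vanish x∈B x≢s)))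
        where
        x = lookup v i₀
        v≡ : v ≡ replicate p x
        v≡ = decidable-stable (≡-dec _≟_ v _) λ v≢ → none (lose v∈ (zs , v≢))
        x∈B : x ∈ B
        x∈B = ∈-vecs⁻ v v∈ i₀
        x≢s : x ≢ s
        x≢s x≡s = v≢s (trans v≡ (cong (replicate p) x≡s))
        at : ∀ i {g} → f i ≡ g → P ∣ g x → P ∣ ∏ (λ i → f i (lookup v i))
        at i refl d = ∏-∣ (λ i → f i (lookup v i)) i
          (subst (λ y → P ∣ f i y) (sym (trans (cong (λ v → lookup v i) v≡) (lookup-replicate i x))) d)

      P∣T-s : P ∣ T (replicate p s)
      P∣T-s = ∣∑⇒∣single (vecs-unique p uB) (∈-vecs⁺ _ λ i → subst (_∈ B) (sym (lookup-replicate i s)) s∈B) P∣T P∣∑T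

      P∤T-s : ¬ P ∣ T (replicate p s)
      -- The factors are `h s`, copies of `e s`, and shifts at a sum of p equal entries, which is 0
      -- modulo p.
      P∤T-s = ∤-*
        (∤-∏ _ λ i → subst (λ y → ¬ P ∣ f i y) (sym (lookup-replicate i s)) (f-case (λ g → ¬ P ∣ g s) P∤h P∤e i))
        (∤-∏ _ λ j → shifts-∤ (c j) nonzeroResidues (replicate p s) ∤-nonzeroResidue (sumOver-replicate (c j) s))

-- Double counting and Turán's bound.

module FiniteCounting where
  open import Data.Nat using (_+_; _*_)
  open ℕSum
  open ℕ.≤-Reasoning

  private variable
    P Q : Set

  𝟙 : Dec P → ℕ
  𝟙 d = if does d then 1 else 0

  𝟙-true : (d : Dec P) → P → 𝟙 d ≡ 1
  𝟙-true (yes _) _ = refl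
  𝟙-true (no ¬p) p = contradiction p ¬p

  𝟙≤1 : (d : Dec P) → 𝟙 d ≤ 1
  𝟙≤1 (yes _) = ℕ.≤-refl
  𝟙≤1 (no _)  = z≤n

  𝟙*≤ : (d : Dec P) {m b : ℕ} → (P → m ≤ b) → 𝟙 d * m ≤ b
  𝟙*≤ (yes p) {m} h = ℕ.≤-trans (ℕ.≤-reflexive (ℕ.+-identityʳ m)) (h p)
  𝟙*≤ (no _)  h = z≤n

  1≤𝟙+𝟙 : (d : Dec P) (e : Dec Q) → P ⊎ Q → 1 ≤ 𝟙 d + 𝟙 e
  1≤𝟙+𝟙 d e (inj₁ p) rewrite 𝟙-true d p = s≤s z≤n
  1≤𝟙+𝟙 d e (inj₂ q) rewrite 𝟙-true e q = ℕ.m≤n+m 1 (𝟙 d)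

  ∑-mono : (L : List A) {f g : A → ℕ} → (∀ {x} → x ∈ L → f x ≤ g x) → ∑ L f ≤ ∑ L g
  ∑-mono []      h = z≤n
  ∑-mono (x ∷ L) h = ℕ.+-mono-≤ (h (here refl)) (∑-mono L (h ∘ there))

  ∑-upper : (L : List A) {f : A → ℕ} {b : ℕ} → (∀ {x} → x ∈ L → f x ≤ b) → ∑ L f ≤ length L * b
  ∑-upper []      h = z≤n
  ∑-upper (x ∷ L) h = ℕ.+-mono-≤ (h (here refl)) (∑-upper L (h ∘ there))

  ∑-lower : (L : List A) {f : A → ℕ} {b : ℕ} → (∀ {x} → x ∈ L → b ≤ f x) → length L * b ≤ ∑ L f
  ∑-lower []      h = z≤n
  ∑-lower (x ∷ L) h = ℕ.+-mono-≤ (h (here refl)) (∑-lower L (h ∘ there))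

  ∈⇒≤∑ : {L : List A} (f : A → ℕ) {x : A} → x ∈ L → f x ≤ ∑ L f
  ∈⇒≤∑ f (here refl) = ℕ.m≤m+n _ _
  ∈⇒≤∑ f (there x∈L) = ℕ.≤-trans (∈⇒≤∑ f x∈L) (ℕ.m≤n+m _ _)

  ∑-1 : (L : List A) → ∑ L (const 1) ≡ length L
  ∑-1 []      = refl
  ∑-1 (x ∷ L) = cong suc (∑-1 L)

  length-partition : {P : A → Set} (P? : ∀ x → Dec (P x)) (L : List A) →
    length L ≡ length (filter P? L) + length (filter (¬? ∘ P?) L)
  length-partition P? L = begin-equality
    length L                                                            ≡⟨ ∑-1 L ⟨
    ∑ L (const 1)                                                       ≡⟨ ∑-partition P? L (const 1) ⟩
    ∑ (filter P? L) (const 1) + ∑ (filter (¬? ∘ P?) L) (const 1)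
      ≡⟨ cong₂ _+_ (∑-1 (filter P? L)) (∑-1 (filter (¬? ∘ P?) L)) ⟩
    length (filter P? L) + length (filter (¬? ∘ P?) L)                  ∎

  ∑𝟙≤1 : {L : List A} {P : A → Set} (P? : ∀ x → Dec (P x)) → Unique L →
         (∀ {x y} → x ∈ L → y ∈ L → P x → P y → x ≡ y) → ∑ L (λ x → 𝟙 (P? x)) ≤ 1
  ∑𝟙≤1 {L = []} P? u h = z≤n
  ∑𝟙≤1 {L = x ∷ L} P? (x∉ ∷ u) h with P? x
  ... | no _  = ∑𝟙≤1 P? u (λ x∈ y∈ → h (there x∈) (there y∈))
  ... | yes p = s≤s (subst (∑ L (λ x → 𝟙 (P? x)) ≤_) (ℕ.*-zeroʳ (length L)) (∑-upper L none))
    where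
    none : ∀ {y} → y ∈ L → 𝟙 (P? y) ≤ 0
    none {y} y∈ with P? y
    ... | no _  = z≤n
    ... | yes q = contradiction (h (here refl) (there y∈) p q) (All.lookup x∉ y∈)

  module IndependentSet {A : Set} {R : A → A → Set} (R? : ∀ x y → Dec (R x y)) where

    adjacency : A → A → ℕ
    adjacency x y = 𝟙 (R? x y) + 𝟙 (R? y x)

    Independent : List A → Set
    Independent I = ∀ {x y} → x ∈ I → y ∈ I → x ≢ y → ¬ R x y

    -- Greedy choice: `x` joins `I` unless it is related to a member of `I`, and then it is paid for
    -- by an adjacency term of that member.
    maximal-independent : (L : List A) → Unique L →
      ∃ λ I → Unique I × (∀ {x} → x ∈ I → x ∈ L) × Independent I ×
              length L ≤ length I + ∑ I (λ y → ∑ L (λ x → adjacency x y))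
    maximal-independent [] u = [] , [] , (λ ()) , (λ ()) , z≤n
    maximal-independent (x ∷ L) (x∉ ∷ u)
      with I , uI , I⊆L , indep , bound ← maximal-independent L u
      with any? (λ y → R? x y ⊎-dec R? y x) I
    ... | yes found with y , y∈I , Rxy ← find found = I , uI , there ∘ I⊆L , indep , (begin
      suc (length L)                                        ≤⟨ ℕ.+-mono-≤ (1≤𝟙+𝟙 (R? x y) (R? y x) Rxy) bound ⟩
      adjacency x y + (length I + S)                        ≤⟨ ℕ.+-monoˡ-≤ _ (∈⇒≤∑ (adjacency x) y∈I) ⟩
      ∑ I (adjacency x) + (length I + S)                    ≡⟨ swap (∑ I (adjacency x)) (length I) S ⟩
      length I + (∑ I (adjacency x) + S)                    ≡⟨ cong (λ z → length I + z) (∑-distrib-+ I _ _) ⟨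
      length I + ∑ I (λ y → ∑ (x ∷ L) (λ x → adjacency x y))  ∎)
      where
      S = ∑ I (λ y → ∑ L (λ x → adjacency x y))
      swap : ∀ a b c → a + (b + c) ≡ b + (a + c)
      swap = ℕ-solve-∀
    ... | no none = x ∷ I , All.tabulate (λ y∈ → All.lookup x∉ (I⊆L y∈)) ∷ uI ,
      (λ { (here eq) → here eq ; (there y∈) → there (I⊆L y∈) }) ,
      (λ { (here refl) (here refl) x≢x _ → x≢x refl
         ; (here refl) (there y∈) _ r → none (lose y∈ (inj₁ r))
         ; (there y∈) (here refl) _ r → none (lose y∈ (inj₂ r))
         ; (there x∈) (there y∈) → indep x∈ y∈ }) ,
      s≤s (begin
        length L                                                     ≤⟨ bound ⟩
        length I + ∑ I (λ y → ∑ L (λ x → adjacency x y))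
          ≤⟨ ℕ.+-monoʳ-≤ (length I) (∑-mono I λ _ → ℕ.m≤n+m _ _) ⟩
        length I + ∑ I (λ y → ∑ (x ∷ L) (λ x → adjacency x y))       ≤⟨ ℕ.+-monoʳ-≤ (length I) (ℕ.m≤n+m _ _) ⟩
        length I + ∑ (x ∷ I) (λ y → ∑ (x ∷ L) (λ x → adjacency x y)) ∎)

    -- Turán's bound up to a constant: by Markov at least half of the vertices have degree at most
    -- twice the average, and a maximal independent set among them dominates them.
    turán : (L : List A) → Unique L → (E : ℕ) → ∑ L (λ x → ∑ L (λ y → 𝟙 (R? x y))) ≤ E →
      ∃ λ I → Unique I × (∀ {x} → x ∈ I → x ∈ L) × Independent I ×
              length L * length L ≤ 2 * (length I * (length L + 4 * E))
    turán L u E ∑∑≤E with I , uI , I⊆Low , indep , bound ← maximal-independent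
        (filter (λ y → length L * ∑ L (λ x → adjacency x y) ℕ.≤? 2 * (2 * E)) L)
        (Unique.filter⁺ _ u) =
      I , uI , proj₁ ∘ ∈-filter⁻ low? ∘ I⊆Low , indep , (begin
        ℓ * ℓ                             ≤⟨ ℕ.*-monoʳ-≤ ℓ ℓ≤2Low ⟩
        ℓ * (2 * length Low)              ≤⟨ ℕ.*-monoʳ-≤ ℓ (ℕ.*-monoʳ-≤ 2 bound) ⟩
        ℓ * (2 * (length I + ∑ I (λ y → ∑ Low (λ x → adjacency x y))))
                                          ≤⟨ ℕ.*-monoʳ-≤ ℓ (ℕ.*-monoʳ-≤ 2 (ℕ.+-monoʳ-≤ (length I) (∑-mono I λ _ → ∑Low≤))) ⟩
        ℓ * (2 * (length I + ∑ I deg))    ≡⟨ lemma ℓ (length I) (∑ I deg) ⟩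
        2 * (length I * ℓ + ℓ * ∑ I deg)  ≡⟨ cong (λ y → 2 * (length I * ℓ + y)) (*-distribˡ-∑ I ℓ deg) ⟩
        2 * (length I * ℓ + ∑ I (λ y → ℓ * deg y))
                                          ≤⟨ ℕ.*-monoʳ-≤ 2 (ℕ.+-monoʳ-≤ (length I * ℓ) (∑-upper I λ y∈ → proj₂ (∈-filter⁻ low? {xs = L} (I⊆Low y∈)))) ⟩
        2 * (length I * ℓ + length I * (2 * (2 * E)))
                                          ≡⟨ lemma₂ ℓ (length I) E ⟩
        2 * (length I * (ℓ + 4 * E))      ∎)
      where
      ℓ = length L
      F = 2 * E
      deg : A → ℕ
      deg y = ∑ L (λ x → adjacency x y)
      low? = λ y → ℓ * deg y ℕ.≤? 2 * F
      Low = filter low? L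
      High = filter (¬? ∘ low?) L

      lemma : ∀ a b c → a * (2 * (b + c)) ≡ 2 * (b * a + a * c)
      lemma = ℕ-solve-∀
      lemma₂ : ∀ a b c → 2 * (b * a + b * (2 * (2 * c))) ≡ 2 * (b * (a + 4 * c))
      lemma₂ = ℕ-solve-∀

      ∑Low≤ : ∀ {y} → ∑ Low (λ x → adjacency x y) ≤ deg y
      ∑Low≤ {y} = ℕ.≤-trans (ℕ.m≤m+n _ _) (ℕ.≤-reflexive (sym (∑-partition low? L (λ x → adjacency x y))))

      ∑deg≤F : ∑ L deg ≤ F
      ∑deg≤F = begin
        ∑ L deg
          ≡⟨ ∑-cong L (λ _ → ∑-distrib-+ L _ _) ⟩
        ∑ L (λ y → ∑ L (λ x → 𝟙 (R? x y)) + ∑ L (λ x → 𝟙 (R? y x)))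
          ≡⟨ ∑-distrib-+ L _ _ ⟩
        ∑ L (λ y → ∑ L (λ x → 𝟙 (R? x y))) + ∑ L (λ y → ∑ L (λ x → 𝟙 (R? y x)))
          ≡⟨ cong (_+ ∑ L (λ y → ∑ L (λ x → 𝟙 (R? y x)))) (∑-swap L L (λ y x → 𝟙 (R? x y))) ⟩
        ∑ L (λ y → ∑ L (λ x → 𝟙 (R? y x))) + ∑ L (λ y → ∑ L (λ x → 𝟙 (R? y x)))
          ≤⟨ ℕ.+-mono-≤ ∑∑≤E ∑∑≤E ⟩
        E + E
          ≡⟨ cong (λ z → E + z) (ℕ.+-identityʳ E) ⟨
        F ∎

      -- High vertices exceed the threshold strictly. The successor keeps the factor positive for
      -- the cancellation in `2High≤ℓ`, even when `E` is 0.
      markov : length High * suc (2 * F) ≤ ℓ * F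
      markov = begin
        length High * suc (2 * F)
          ≤⟨ ∑-lower High (λ y∈ → ℕ.≰⇒> (proj₂ (∈-filter⁻ (¬? ∘ low?) {xs = L} y∈))) ⟩
        ∑ High (λ y → ℓ * deg y)                           ≤⟨ ℕ.m≤n+m _ _ ⟩
        ∑ Low (λ y → ℓ * deg y) + ∑ High (λ y → ℓ * deg y) ≡⟨ ∑-partition low? L _ ⟨
        ∑ L (λ y → ℓ * deg y)                              ≡⟨ *-distribˡ-∑ L ℓ deg ⟨
        ℓ * ∑ L deg                                        ≤⟨ ℕ.*-monoʳ-≤ ℓ ∑deg≤F ⟩
        ℓ * F                                              ∎

      2High≤ℓ : 2 * length High ≤ ℓ
      2High≤ℓ = ℕ.*-cancelˡ-≤ (suc (2 * F)) (begin
        suc (2 * F) * (2 * length High)  ≡⟨ lemma₃ (suc (2 * F)) (length High) ⟩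
        2 * (length High * suc (2 * F))  ≤⟨ ℕ.*-monoʳ-≤ 2 markov ⟩
        2 * (ℓ * F)                      ≡⟨ lemma₄ ℓ F ⟩
        2 * F * ℓ                        ≤⟨ ℕ.*-monoˡ-≤ ℓ (ℕ.n≤1+n (2 * F)) ⟩
        suc (2 * F) * ℓ                  ∎)
        where
        lemma₃ : ∀ a b → a * (2 * b) ≡ 2 * (b * a)
        lemma₃ = ℕ-solve-∀
        lemma₄ : ∀ a b → 2 * (a * b) ≡ 2 * b * a
        lemma₄ = ℕ-solve-∀

      ℓ≤2Low : ℓ ≤ 2 * length Low
      ℓ≤2Low = ℕ.+-cancelʳ-≤ ℓ ℓ (2 * length Low) (begin
        ℓ + ℓ                                ≡⟨ cong₂ _+_ (length-partition low? L) (length-partition low? L) ⟩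
        (length Low + length High) + (length Low + length High)
                                             ≡⟨ lemma₃ (length Low) (length High) ⟩
        2 * length Low + 2 * length High     ≤⟨ ℕ.+-monoʳ-≤ (2 * length Low) 2High≤ℓ ⟩
        2 * length Low + ℓ                   ∎)
        where
        lemma₃ : ∀ a b → (a + b) + (a + b) ≡ 2 * a + 2 * b
        lemma₃ = ℕ-solve-∀

open FiniteCounting

-- Addition in F_p^n and sums with many representations.

module PopularSums (p : ℕ) (p-prime : Prime p) (2<p : 2 < p) (n : ℕ) where
  open import Data.Integer using (0ℤ; 1ℤ; _+_; _-_; _*_; -_)
  open ℕSum using (∑)
  open ModPrime p p-prime
  open SliceBound p p-prime using (p-nonZero)

  X : Set
  X = Vec (Fin p) n

  _≟_ : DecidableEquality X
  _≟_ = ≡-dec Fin._≟_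

  open DecMembership _≟_ using (_∈?_)

  -- Coordinates as integers in [0, p); equations in F_p^n become divisibility by p of expressions
  -- in them.
  c : Fin n → X → ℤ
  c j x = + toℕ (lookup x j)

  private
    ∣-<⇒≡0 : ∀ {m} → m < p → p ℕ.∣ m → m ≡ 0
    ∣-<⇒≡0 {zero}  m<p d = refl
    ∣-<⇒≡0 {suc m} m<p d = contradiction (ℕ.∣⇒≤ d) (ℕ.<⇒≱ m<p)

    residue-injective-≤ : ∀ {a b} → a ≤ b → b < p → P ∣ + a - + b → a ≡ b
    residue-injective-≤ {a} {b} a≤b b<p d = ℕ.≤-antisym a≤b (ℕ.m∸n≡0⇒m≤n
      (∣-<⇒≡0 (ℕ.≤-<-trans (ℕ.m∸n≤m b a) b<p)
        (subst (p ℕ.∣_) (trans (cong ℤ.∣_∣ (ℤ.m-n≡m⊖n a b)) (ℤ.∣⊖∣-≤ a≤b)) (∣⇒∣ᵤ d))))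

  residue-injective : ∀ {a b} → a < p → b < p → P ∣ + a - + b → a ≡ b
  residue-injective {a} {b} a<p b<p d with ℕ.≤-total a b
  ... | inj₁ a≤b = residue-injective-≤ a≤b b<p d
  ... | inj₂ b≤a = sym (residue-injective-≤ b≤a a<p (subst (P ∣_) (flip (+ a) (+ b)) (∣m⇒∣-m d)))
    where
    flip : ∀ x y → - (x - y) ≡ y - x
    flip = ℤ-solve-∀

  c-injective : ∀ {x y} → (∀ j → P ∣ c j x - c j y) → x ≡ y
  c-injective {x} {y} d = trans (sym (tabulate∘lookup x)) (trans
    (tabulate-cong λ j → Fin.toℕ-injective (residue-injective (toℕ<n _) (toℕ<n _) (d j)))
    (tabulate∘lookup y))

  add : X → X → X
  add = Vec.zipWith (λ a b → (toℕ a ℕ.+ toℕ b) mod p)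

  add-sum : ∀ j x y → P ∣ (c j x + c j y) - c j (add x y)
  add-sum j x y = divides (+ (s ℕ./ p)) (begin
    (+ toℕ a + + toℕ b) - c j (add x y)
      ≡⟨ cong₂ _-_ (sym (ℤ.pos-+ (toℕ a) (toℕ b))) (cong +_ (trans (cong toℕ (lookup-zipWith _ j x y)) (toℕ-fromℕ< _))) ⟩
    + s - + (s ℕ.% p)                                   ≡⟨ cong (λ t → + t - + (s ℕ.% p)) (ℕ.m≡m%n+[m/n]*n s p) ⟩
    + (s ℕ.% p ℕ.+ s ℕ./ p ℕ.* p) - + (s ℕ.% p)
      ≡⟨ cong (_- + (s ℕ.% p)) (trans (ℤ.pos-+ (s ℕ.% p) _) (cong (λ t → + (s ℕ.% p) + t) (ℤ.pos-* (s ℕ./ p) p))) ⟩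
    (+ (s ℕ.% p) + + (s ℕ./ p) * P) - + (s ℕ.% p)       ≡⟨ cancel (+ (s ℕ.% p)) _ ⟩
    + (s ℕ./ p) * P                                     ∎)
    where
    open ≡-Reasoning
    a = lookup x j
    b = lookup y j
    s = toℕ a ℕ.+ toℕ b
    cancel : ∀ x y → x + y - x ≡ y
    cancel = ℤ-solve-∀

  add-≡ : ∀ {a b x y} → add a b ≡ add x y → ∀ j → P ∣ (c j a + c j b) - (c j x + c j y)
  add-≡ {a} {b} {x} {y} eq j = subst (P ∣_)
    (trans (cong (λ z → (c j a + c j b) - z - ((c j x + c j y) - c j (add x y))) (cong (c j) eq))
      (cancel (c j a + c j b) (c j x + c j y) (c j (add x y))))
    (∣m∣n⇒∣m-n (add-sum j a b) (add-sum j x y))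
    where
    cancel : ∀ u v k → (u - k) - (v - k) ≡ u - v
    cancel = ℤ-solve-∀

  add-cancelˡ : ∀ {a b b′} → add a b ≡ add a b′ → b ≡ b′
  add-cancelˡ {a} {b} {b′} eq = c-injective λ j → subst (P ∣_) (cancel (c j a) (c j b) (c j b′)) (add-≡ eq j)
    where
    cancel : ∀ a b b′ → (a + b) - (a + b′) ≡ b - b′
    cancel = ℤ-solve-∀

  add-cancelʳ : ∀ {a a′ b} → add a b ≡ add a′ b → a ≡ a′
  add-cancelʳ {a} {a′} {b} eq = c-injective λ j → subst (P ∣_) (cancel (c j a) (c j a′) (c j b)) (add-≡ eq j)
    where
    cancel : ∀ a a′ b → (a + b) - (a′ + b) ≡ a - a′
    cancel = ℤ-solve-∀

  -- The difference of the doubles is twice `a - b`, and p > 2 does not divide 2.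
  add-double : ∀ {a b} → add a a ≡ add b b → a ≡ b
  add-double {a} {b} eq = c-injective λ j →
    [ (λ P∣2 → contradiction (ℕ.∣⇒≤ (∣⇒∣ᵤ P∣2)) (ℕ.<⇒≱ 2<p)) , (λ d → d) ]′
      (euclid {+ 2} (subst (P ∣_) (double (c j a) (c j b)) (add-≡ eq j)))
    where
    double : ∀ a b → (a + a) - (b + b) ≡ + 2 * (a - b)
    double = ℤ-solve-∀

  Zero : List X → Set
  Zero L = ∀ j → P ∣ ℤSum.∑ L (c j)

  -- At most 2p + 1 pairs with a given sum have equal entries or an entry in a given list of length p.
  r : ℕ
  r = 2 ℕ.* p ℕ.+ 2

  module _ (A : List X) (A-unique : Unique A) where

    pairs : List (X × X)
    pairs = cartesianProduct A A

    pairs-unique : Unique pairs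
    pairs-unique = Unique.cartesianProduct⁺ A-unique A-unique

    hasSum? : ∀ z (ab : X × X) → Dec (add (proj₁ ab) (proj₂ ab) ≡ z)
    hasSum? z (a , b) = add a b ≟ z

    representations : X → ℕ
    representations z = ∑ pairs (𝟙 ∘ hasSum? z)

    Unpopular : X → X → Set
    Unpopular x y = representations (add x y) < r

    unpopular? : ∀ x y → Dec (Unpopular x y)
    unpopular? x y = representations (add x y) ℕ.<? r

    Zs : List X
    Zs = vecs (allFin p) n

    ∈-Zs : ∀ z → z ∈ Zs
    ∈-Zs z = ∈-vecs⁺ z λ _ → ∈-allFin _

    |Zs| : length Zs ≡ p ℕ.^ n
    |Zs| = trans (length-vecs (allFin p) n) (cong (ℕ._^ n) (List.length-tabulate {n = p} (λ i → i)))

    |A|≤ : length A ≤ p ℕ.^ n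
    |A|≤ = subst (length A ≤_) |Zs| (Unique-⊆⇒length≤ A-unique λ {x} _ → ∈-Zs x)

    -- Pairs are grouped by their sum: each of the p^n possible sums is either popular, and
    -- contributes nothing, or has fewer than `r` pairs.
    few-unpopular : ∑ A (λ x → ∑ A (λ y → 𝟙 (unpopular? x y))) ≤ p ℕ.^ n ℕ.* r
    few-unpopular = begin
      ∑ A (λ x → ∑ A (λ y → 𝟙 (unpopular? x y)))
        ≡⟨ ℕSum.∑-cartesianProductWith _,_ A A _ ⟨
      ∑ pairs (λ xy → 𝟙 (low? (add (proj₁ xy) (proj₂ xy))))
        ≤⟨ ∑-mono pairs (λ {xy} _ → via (add (proj₁ xy) (proj₂ xy))) ⟩
      ∑ pairs (λ xy → ∑ Zs (λ z → 𝟙 (low? z) ℕ.* 𝟙 (hasSum? z xy)))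
        ≡⟨ ℕSum.∑-swap pairs Zs _ ⟩
      ∑ Zs (λ z → ∑ pairs (λ xy → 𝟙 (low? z) ℕ.* 𝟙 (hasSum? z xy)))
        ≡⟨ ℕSum.∑-cong Zs (λ {z} _ → ℕSum.*-distribˡ-∑ pairs (𝟙 (low? z)) _) ⟨
      ∑ Zs (λ z → 𝟙 (low? z) ℕ.* representations z)
        ≤⟨ ∑-upper Zs (λ {z} _ → small z) ⟩
      length Zs ℕ.* r
        ≡⟨ cong (ℕ._* r) |Zs| ⟩
      p ℕ.^ n ℕ.* r ∎
      where
      open ℕ.≤-Reasoning
      low? : ∀ z → Dec (representations z < r)
      low? z = representations z ℕ.<? r
      via : ∀ z → 𝟙 (low? z) ≤ ∑ Zs (λ z′ → 𝟙 (low? z′) ℕ.* 𝟙 (z ≟ z′))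
      via z = begin
        𝟙 (low? z)                  ≡⟨ ℕ.*-identityʳ _ ⟨
        𝟙 (low? z) ℕ.* 1            ≡⟨ cong (𝟙 (low? z) ℕ.*_) (𝟙-true (z ≟ z) refl) ⟨
        𝟙 (low? z) ℕ.* 𝟙 (z ≟ z)    ≤⟨ ∈⇒≤∑ (λ z′ → 𝟙 (low? z′) ℕ.* 𝟙 (z ≟ z′)) (∈-Zs z) ⟩
        ∑ Zs (λ z′ → 𝟙 (low? z′) ℕ.* 𝟙 (z ≟ z′)) ∎
      small : ∀ z → 𝟙 (low? z) ℕ.* representations z ≤ r
      small z = 𝟙*≤ (low? z) ℕ.<⇒≤

    -- Counts the pairs to be avoided. By cancellation each `q` in `Q` is the first entry of at most
    -- one pair with the given sum and the second entry of at most one; as doubling is injective, at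
    -- most one pair has equal entries.
    fresh-pair : ∀ {x y} → ¬ Unpopular x y → (Q : List X) → length Q ≤ p →
      ∃₂ λ a b → a ∈ A × b ∈ A × a ∉ Q × b ∉ Q × a ≢ b × add a b ≡ add x y
    fresh-pair {x} {y} popular Q |Q|≤p
      with any? (λ ab → hasSum? (add x y) ab ×-dec ¬? (proj₁ ab ∈? Q) ×-dec ¬? (proj₂ ab ∈? Q) ×-dec ¬? (proj₁ ab ≟ proj₂ ab)) pairs
    ... | yes found with (a , b) , ab∈ , k , a∉ , b∉ , a≢b ← find found =
      a , b , proj₁ (∈-cartesianProduct⁻ A A ab∈) , proj₂ (∈-cartesianProduct⁻ A A ab∈) , a∉ , b∉ , a≢b , k
    ... | no none = contradiction (ℕ.≤-<-trans bound (ℕ.≤-<-trans (ℕ.+-monoˡ-≤ 1 (ℕ.*-monoˡ-≤ 2 |Q|≤p)) 2p+1<r)) popular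
      where
      open ℕ.≤-Reasoning
      z = add x y
      first? : ∀ q ab → Dec (add (proj₁ ab) (proj₂ ab) ≡ z × proj₁ ab ≡ q)
      first? q ab = hasSum? z ab ×-dec (proj₁ ab ≟ q)
      second? : ∀ q ab → Dec (add (proj₁ ab) (proj₂ ab) ≡ z × proj₂ ab ≡ q)
      second? q ab = hasSum? z ab ×-dec (proj₂ ab ≟ q)
      equal? : ∀ ab → Dec (add (proj₁ ab) (proj₂ ab) ≡ z × proj₁ ab ≡ proj₂ ab)
      equal? ab = hasSum? z ab ×-dec (proj₁ ab ≟ proj₂ ab)

      2p+1<r : p ℕ.* 2 ℕ.+ 1 < r
      2p+1<r = ℕ.≤-reflexive (lemma p)
        where
        lemma : ∀ p → suc (p ℕ.* 2 ℕ.+ 1) ≡ 2 ℕ.* p ℕ.+ 2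
        lemma = ℕ-solve-∀

      cover : ∀ {ab} → ab ∈ pairs →
        𝟙 (hasSum? z ab) ≤ ∑ Q (λ q → 𝟙 (first? q ab) ℕ.+ 𝟙 (second? q ab)) ℕ.+ 𝟙 (equal? ab)
      cover {a , b} ab∈ with add a b ≟ z
      ... | no _  = z≤n
      ... | yes k = cases (a ∈? Q) (b ∈? Q) (a ≟ b)
        where
        rhs = ∑ Q (λ q → 𝟙 (yes k ×-dec (a ≟ q)) ℕ.+ 𝟙 (yes k ×-dec (b ≟ q))) ℕ.+ 𝟙 (yes k ×-dec (a ≟ b))
        hit : ∀ {q} → q ∈ Q → a ≡ q ⊎ b ≡ q → 1 ≤ rhs
        hit {q} q∈ a∨b = ℕ.m≤n⇒m≤n+o _ (ℕ.≤-trans (1≤𝟙+𝟙 (yes k ×-dec (a ≟ q)) (yes k ×-dec (b ≟ q)) (Sum.map (k ,_) (k ,_) a∨b))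
          (∈⇒≤∑ (λ q → 𝟙 (yes k ×-dec (a ≟ q)) ℕ.+ 𝟙 (yes k ×-dec (b ≟ q))) q∈))
        cases : Dec (a ∈ Q) → Dec (b ∈ Q) → Dec (a ≡ b) → 1 ≤ rhs
        cases (yes a∈) _        _         = hit a∈ (inj₁ refl)
        cases (no _)   (yes b∈) _         = hit b∈ (inj₂ refl)
        cases (no _)   (no _)   (yes a≡b) = ℕ.m≤n⇒m≤o+n _ (ℕ.≤-reflexive (sym (𝟙-true (yes k ×-dec (a ≟ b)) (k , a≡b))))
        cases (no a∉)  (no b∉)  (no a≢b)  = contradiction (lose ab∈ (k , a∉ , b∉ , a≢b)) none

      bound : representations z ≤ length Q ℕ.* 2 ℕ.+ 1
      bound = begin
        representations z
          ≤⟨ ∑-mono pairs cover ⟩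
        ∑ pairs (λ ab → ∑ Q (λ q → 𝟙 (first? q ab) ℕ.+ 𝟙 (second? q ab)) ℕ.+ 𝟙 (equal? ab))
          ≡⟨ ℕSum.∑-distrib-+ pairs _ _ ⟩
        ∑ pairs (λ ab → ∑ Q (λ q → 𝟙 (first? q ab) ℕ.+ 𝟙 (second? q ab))) ℕ.+ ∑ pairs (𝟙 ∘ equal?)
          ≡⟨ cong (ℕ._+ ∑ pairs (𝟙 ∘ equal?)) (trans (ℕSum.∑-swap pairs Q _) (ℕSum.∑-cong Q λ _ → ℕSum.∑-distrib-+ pairs _ _)) ⟩
        ∑ Q (λ q → ∑ pairs (𝟙 ∘ first? q) ℕ.+ ∑ pairs (𝟙 ∘ second? q)) ℕ.+ ∑ pairs (𝟙 ∘ equal?)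
          ≤⟨ ℕ.+-mono-≤ (∑-upper Q λ {q} _ → ℕ.+-mono-≤
               (∑𝟙≤1 (first? q) pairs-unique λ { _ _ (k , refl) (k′ , refl) → cong (_ ,_) (add-cancelˡ (trans k (sym k′))) })
               (∑𝟙≤1 (second? q) pairs-unique λ { _ _ (k , refl) (k′ , refl) → cong (_, _) (add-cancelʳ (trans k (sym k′))) }))
               (∑𝟙≤1 equal? pairs-unique λ { _ _ (k , refl) (k′ , refl) → cong (λ a → a , a) (add-double (trans k (sym k′))) }) ⟩
        length Q ℕ.* 2 ℕ.+ 1 ∎

-- Words of bounded length.

lists : List A → ℕ → List (List A)
lists Y zero    = [] ∷ []
lists Y (suc k) = [] ∷ cartesianProductWith _∷_ Y (lists Y k)

∈-lists⁺ : {Y R : List A} {k : ℕ} → length R ≤ k → (∀ {y} → y ∈ R → y ∈ Y) → R ∈ lists Y k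
∈-lists⁺ {R = []}    {zero}  _         _   = here refl
∈-lists⁺ {R = []}    {suc k} _         _   = here refl
∈-lists⁺ {R = y ∷ R} {suc k} (s≤s R≤k) R⊆Y =
  there (∈-cartesianProductWith⁺ _∷_ (R⊆Y (here refl)) (∈-lists⁺ R≤k (R⊆Y ∘ there)))

∈-lists⁻ : {Y R : List A} (k : ℕ) → R ∈ lists Y k → length R ≤ k × (∀ {y} → y ∈ R → y ∈ Y)
∈-lists⁻ zero    (here refl) = z≤n , λ ()
∈-lists⁻ (suc k) (here refl) = z≤n , λ ()
∈-lists⁻ {Y = Y} (suc k) (there R∈) with ∈-cartesianProductWith⁻ _∷_ Y (lists Y k) R∈
... | y , R , y∈ , R∈′ , refl with R≤k , R⊆Y ← ∈-lists⁻ k R∈′ =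
  s≤s R≤k , λ { (here refl) → y∈ ; (there z∈) → R⊆Y z∈ }

-- Multiplicities and splitting off distinct elements.

module Multiplicity {A : Set} (_≟_ : DecidableEquality A) where
  open ℕSum using (∑)

  count : A → List A → ℕ
  count x L = ∑ L (λ y → 𝟙 (x ≟ y))

  count≤length : ∀ x L → count x L ≤ length L
  count≤length x L = ℕ.≤-trans (∑-mono L λ {y} _ → 𝟙≤1 (x ≟ y)) (ℕ.≤-reflexive (∑-1 L))

  count-++ : ∀ x L M → count x (L ++ M) ≡ count x L ℕ.+ count x M
  count-++ x L M = ℕSum.∑-++ L M _

  ∉⇒count≡0 : ∀ {x L} → x ∉ L → count x L ≡ 0
  ∉⇒count≡0 {x} {[]}    x∉ = refl
  ∉⇒count≡0 {x} {y ∷ L} x∉ with x ≟ y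
  ... | yes refl = contradiction (here refl) x∉
  ... | no  _    = ∉⇒count≡0 (x∉ ∘ there)

  count-two : ∀ {x y} L → x ≢ y → count x L ℕ.+ count y L ≤ length L
  count-two {x} {y} L x≢y = begin
    count x L ℕ.+ count y L                      ≡⟨ ℕSum.∑-distrib-+ L _ _ ⟨
    ∑ L (λ z → 𝟙 (x ≟ z) ℕ.+ 𝟙 (y ≟ z))          ≤⟨ ∑-mono L (λ {z} _ → exclusive z) ⟩
    ∑ L (const 1)                                ≡⟨ ∑-1 L ⟩
    length L                                     ∎
    where
    open ℕ.≤-Reasoning
    exclusive : ∀ z → 𝟙 (x ≟ z) ℕ.+ 𝟙 (y ≟ z) ≤ 1
    exclusive z with x ≟ z | y ≟ z
    ... | yes refl | yes refl = contradiction refl x≢y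
    ... | yes _    | no _     = ℕ.≤-refl
    ... | no _     | yes _    = ℕ.≤-refl
    ... | no _     | no _     = z≤n

  count-replicate : ∀ x L → (∀ {y} → y ∈ L → y ≡ x) → count x L ≡ length L
  count-replicate x []      h = refl
  count-replicate x (y ∷ L) h with x ≟ y
  ... | yes _  = cong suc (count-replicate x L (h ∘ there))
  ... | no x≢y = contradiction (sym (h (here refl))) x≢y

  count-filter : ∀ x L → count x L ≡ length (filter (x ≟_) L)
  count-filter x []      = refl
  count-filter x (y ∷ L) with x ≟ y
  ... | yes _ = cong suc (count-filter x L)
  ... | no _  = count-filter x L

  count-resp-↭ : ∀ x {L M} → L ↭ M → count x L ≡ count x M
  count-resp-↭ x L↭M = ℕSum.∑-↭ L↭M _

  -- Two elements of multiplicity m + 2 would need 2m + 4 places, but there are 2m + 3. So `x` is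
  -- the one exceptional element if it exists, and the head of the list otherwise.
  majority : ∀ m L → length L ≡ suc (2 ℕ.* suc m) → (∀ z → count z L ≤ suc (suc m)) →
             ∃ λ x → x ∈ L × (∀ z → z ≢ x → count z L ≤ suc m)
  majority m L |L| count≤ with any? (λ x → count x L ℕ.≟ suc (suc m)) L
  ... | yes found with x , x∈ , eq ← find found = x , x∈ , λ z z≢x → ℕ.≮⇒≥ λ m<count →
    ℕ.<⇒≱ (ℕ.n<1+n (length L)) (begin
      suc (length L)                   ≡⟨ cong suc |L| ⟩
      suc (suc (2 ℕ.* suc m))          ≡⟨ lemma m ⟩
      suc (suc m) ℕ.+ suc (suc m)      ≤⟨ ℕ.+-mono-≤ m<count (ℕ.≤-reflexive (sym eq)) ⟩
      count z L ℕ.+ count x L          ≤⟨ count-two L z≢x ⟩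
      length L                         ∎)
    where
    open ℕ.≤-Reasoning
    lemma : ∀ m → suc (suc (2 ℕ.* suc m)) ≡ suc (suc m) ℕ.+ suc (suc m)
    lemma = ℕ-solve-∀
  majority m (x ∷ L) |L| count≤ | no none = x , here refl , λ z _ → bound z
    where
    open DecMembership _≟_ using (_∈?_)
    bound : ∀ z → count z (x ∷ L) ≤ suc m
    bound z with z ∈? (x ∷ L)
    ... | yes z∈ = ℕ.s≤s⁻¹ (ℕ.≤∧≢⇒< (count≤ z) λ eq → none (lose z∈ eq))
    ... | no z∉ = subst (_≤ suc m) (sym (∉⇒count≡0 z∉)) z≤n

  -- Taking `x` from `majority` lowers the only multiplicity that can be too large for the next
  -- step. A different `y` exists because a constant list would have multiplicity 2m + 3, more than
  -- m + 2.
  split-distinct : ∀ m L → length L ≡ suc (2 ℕ.* suc m) → (∀ z → count z L ≤ suc (suc m)) →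
    ∃₂ λ x y → ∃ λ L′ → L ↭ x ∷ y ∷ L′ × x ≢ y × (∀ z → count z L′ ≤ suc m)
  split-distinct m L |L| count≤ with x , x∈ , other ← majority m L |L| count≤
    with any? (λ y → ¬? (y ≟ x)) L
  ... | no none = contradiction (count≤ x) (ℕ.<⇒≱ (begin-strict
    suc (suc m)          <⟨ s≤s (ℕ.m≤n+m (suc (suc m)) m) ⟩
    suc (m ℕ.+ suc (suc m))  ≡⟨ lemma m ⟩
    suc (2 ℕ.* suc m)    ≡⟨ |L| ⟨
    length L             ≡⟨ count-replicate x L (λ {y} y∈ → decidable-stable (y ≟ x) λ y≢x → none (lose y∈ y≢x)) ⟨
    count x L            ∎))
    where
    open ℕ.≤-Reasoning
    lemma : ∀ m → suc (m ℕ.+ suc (suc m)) ≡ suc (2 ℕ.* suc m)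
    lemma m = cong suc (trans (ℕ.+-suc m (suc m)) (cong (λ k → suc (m ℕ.+ suc k)) (sym (ℕ.+-identityʳ m))))
  ... | yes found with y , y∈ , y≢x ← find found
    with L₁ , L↭₁ ← ∈⇒↭ x∈
    with L₂ , L↭₂ ← ∈⇒↭ (tail-∈ (∈-resp-↭ L↭₁ y∈) y≢x) =
    x , y , L₂ , L↭ , y≢x ∘ sym , bound
    where
    L↭ : L ↭ x ∷ y ∷ L₂
    L↭ = ↭.trans L↭₁ (↭.prep x L↭₂)
    open ℕ.≤-Reasoning
    bound : ∀ z → count z L₂ ≤ suc m
    bound z with z ≟ x
    ... | no z≢x = begin
      count z L₂                                   ≤⟨ ℕ.≤-trans (ℕ.m≤n+m _ (𝟙 (z ≟ y))) (ℕ.m≤n+m _ (𝟙 (z ≟ x))) ⟩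
      count z (x ∷ y ∷ L₂)                         ≡⟨ count-resp-↭ z L↭ ⟨
      count z L                                    ≤⟨ other z z≢x ⟩
      suc m                                        ∎
    ... | yes refl = ℕ.s≤s⁻¹ (begin
      suc (count x L₂)                             ≡⟨ cong (ℕ._+ count x L₂) (𝟙-true (x ≟ x) refl) ⟨
      𝟙 (x ≟ x) ℕ.+ count x L₂                     ≤⟨ ℕ.+-monoʳ-≤ (𝟙 (x ≟ x)) (ℕ.m≤n+m _ (𝟙 (x ≟ y))) ⟩
      count x (x ∷ y ∷ L₂)                         ≡⟨ count-resp-↭ x L↭ ⟨
      count x L                                    ≤⟨ count≤ x ⟩
      suc (suc m)                                  ∎)

-- Replacing pairs by fresh pairs with the same sum.

module PairReplacement (p : ℕ) (p-prime : Prime p) (2<p : 2 < p) (n : ℕ) where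
  open import Data.Integer using (0ℤ; 1ℤ; _+_; _-_; _*_; -_)
  open ModPrime p p-prime
  open PopularSums p p-prime 2<p n
  open Multiplicity _≟_ public
  open DecMembership _≟_ using (_∈?_)

  module _ (A : List X) (A-unique : Unique A) (B : List X) (B⊆A : ∀ {x} → x ∈ B → x ∈ A)
           (popular : ∀ {x y} → x ∈ B → y ∈ B → x ≢ y → ¬ Unpopular A A-unique x y) where

    -- O is the part of the cycle still to be made distinct, F the fresh elements found so far.
    replace-pairs : ∀ m (O F : List X) → length O ≡ suc (2 ℕ.* m) → (∀ {x} → x ∈ O → x ∈ B) →
      (∀ z → count z O ≤ suc m) → Unique F → (∀ {x} → x ∈ F → x ∈ A) → (∀ {x} → x ∈ F → x ∉ O) →
      length O ℕ.+ length F ≡ p → Zero (O ++ F) →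
      ∃ λ L → Unique L × (∀ {x} → x ∈ L → x ∈ A) × length L ≡ p × Zero L
    -- The leftover element lies in `A` and outside `F`, so it can be kept.
    replace-pairs zero (o ∷ []) F |O| O⊆B count≤ uF F⊆A F∉O |OF| zs =
      o ∷ F , All.tabulate (λ { x∈ refl → F∉O x∈ (here refl) }) ∷ uF ,
      (λ { (here refl) → B⊆A (O⊆B (here refl)) ; (there x∈) → F⊆A x∈ }) , |OF| , zs
    replace-pairs (suc m) O F |O| O⊆B count≤ uF F⊆A F∉O |OF| zs
      with x , y , O′ , O↭ , x≢y , count≤′ ← split-distinct m O |O| count≤
      -- `x` and `y` are distinct elements of `B`, so their sum is popular. The pair has to avoid
      -- `O ++ F`, which has exactly p entries, within the limit of `fresh-pair`.
      with a , b , a∈ , b∈ , a∉ , b∉ , a≢b , k ← fresh-pair A A-unique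
             (popular (O⊆B (∈-resp-↭ (↭-sym O↭) (here refl))) (O⊆B (∈-resp-↭ (↭-sym O↭) (there (here refl)))) x≢y)
             (O ++ F) (ℕ.≤-reflexive (trans (List.length-++ O) |OF|)) =
      replace-pairs m O′ (a ∷ b ∷ F) |O′| (O⊆B ∘ O′⊆O) count≤′
        ((a≢b ∷ All.tabulate (λ { z∈ refl → a∉ (∈-++⁺ʳ O z∈) })) ∷ All.tabulate (λ { z∈ refl → b∉ (∈-++⁺ʳ O z∈) }) ∷ uF)
        (λ { (here refl) → a∈ ; (there (here refl)) → b∈ ; (there (there z∈)) → F⊆A z∈ })
        (λ { (here refl) → a∉ ∘ ∈-++⁺ˡ ∘ O′⊆O
           ; (there (here refl)) → b∉ ∘ ∈-++⁺ˡ ∘ O′⊆O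
           ; (there (there z∈)) → F∉O z∈ ∘ O′⊆O })
        (trans (trans (ℕ.+-suc _ _) (cong suc (ℕ.+-suc _ _))) (trans (cong (ℕ._+ length F) (sym (↭-length O↭))) |OF|))
        zs′
      where
      O′⊆O : ∀ {z} → z ∈ O′ → z ∈ O
      O′⊆O = ∈-resp-↭ (↭-sym O↭) ∘ there ∘ there
      |O′| : length O′ ≡ suc (2 ℕ.* m)
      |O′| = ℕ.suc-injective (ℕ.suc-injective (trans (sym (↭-length O↭)) (trans |O| (lemma m))))
        where
        lemma : ∀ m → ℕ.suc (2 ℕ.* suc m) ≡ suc (suc (suc (2 ℕ.* m)))
        lemma m = cong (λ k → ℕ.suc (ℕ.suc k)) (ℕ.+-suc m (m ℕ.+ 0))
      zs′ : Zero (O′ ++ a ∷ b ∷ F)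
      zs′ j = subst (P ∣_) (trans
          (cong (_+ (c j a + c j b - (c j x + c j y))) (trans (ℤSum.∑-++ O F (c j)) (cong (_+ ℤSum.∑ F (c j)) (ℤSum.∑-↭ O↭ (c j)))))
          (trans (lemma (c j x) (c j y) (ℤSum.∑ O′ (c j)) (ℤSum.∑ F (c j)) (c j a) (c j b)) (sym (ℤSum.∑-++ O′ (a ∷ b ∷ F) (c j)))))
        (∣m∣n⇒∣m+n (zs j) (add-≡ k j))
        where
        lemma : ∀ x y o f a b → (x + (y + o)) + f + ((a + b) - (x + y)) ≡ o + (a + (b + f))
        lemma = ℤ-solve-∀

-- Arithmetic of the size bounds.

private
  -- Turán's inequality with at most `b * h` edges, divided by `b`; an empty set is treated apart.
  cancel-size : ∀ b i m h → i ≤ m ℕ.+ m → b ℕ.* b ≤ 2 ℕ.* (i ℕ.* (b ℕ.+ 4 ℕ.* (b ℕ.* h))) → b ≤ 4 ℕ.* m ℕ.* (1 ℕ.+ 4 ℕ.* h)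
  cancel-size zero      i m h _    _     = z≤n
  cancel-size b@(suc _) i m h i≤2m bound = ℕ.*-cancelˡ-≤ b (begin
    b ℕ.* b                                        ≤⟨ bound ⟩
    2 ℕ.* (i ℕ.* (b ℕ.+ 4 ℕ.* (b ℕ.* h)))          ≤⟨ ℕ.*-monoʳ-≤ 2 (ℕ.*-monoˡ-≤ _ i≤2m) ⟩
    2 ℕ.* ((m ℕ.+ m) ℕ.* (b ℕ.+ 4 ℕ.* (b ℕ.* h)))  ≡⟨ lemma m b h ⟩
    b ℕ.* (4 ℕ.* m ℕ.* (1 ℕ.+ 4 ℕ.* h))            ∎)
    where
    open ℕ.≤-Reasoning
    lemma : ∀ m b h → 2 ℕ.* ((m ℕ.+ m) ℕ.* (b ℕ.+ 4 ℕ.* (b ℕ.* h))) ≡ b ℕ.* (4 ℕ.* m ℕ.* (1 ℕ.+ 4 ℕ.* h))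
    lemma = ℕ-solve-∀

  -- Inserts the bound for the popular set `b` into Turán's inequality for `a`, where `q` stands for
  -- p^n and there are at most `q * r` edges.
  combine : ∀ a b m h q r → a ℕ.* a ≤ 2 ℕ.* (b ℕ.* (a ℕ.+ 4 ℕ.* (q ℕ.* r))) → b ≤ 4 ℕ.* m ℕ.* (1 ℕ.+ 4 ℕ.* h) → a ≤ q →
    a ℕ.* a ≤ 8 ℕ.* (1 ℕ.+ 4 ℕ.* h) ℕ.* (1 ℕ.+ 4 ℕ.* r) ℕ.* (m ℕ.* q)
  combine a b m h q r bound b≤ a≤q = begin
    a ℕ.* a
      ≤⟨ bound ⟩
    2 ℕ.* (b ℕ.* (a ℕ.+ 4 ℕ.* (q ℕ.* r)))
      ≤⟨ ℕ.*-monoʳ-≤ 2 (ℕ.*-mono-≤ b≤ (ℕ.+-monoˡ-≤ (4 ℕ.* (q ℕ.* r)) a≤q)) ⟩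
    2 ℕ.* (4 ℕ.* m ℕ.* (1 ℕ.+ 4 ℕ.* h) ℕ.* (q ℕ.+ 4 ℕ.* (q ℕ.* r)))
      ≡⟨ lemma m h q r ⟩
    8 ℕ.* (1 ℕ.+ 4 ℕ.* h) ℕ.* (1 ℕ.+ 4 ℕ.* r) ℕ.* (m ℕ.* q) ∎
    where
    open ℕ.≤-Reasoning
    lemma : ∀ m h q r → 2 ℕ.* (4 ℕ.* m ℕ.* (1 ℕ.+ 4 ℕ.* h) ℕ.* (q ℕ.+ 4 ℕ.* (q ℕ.* r)))
                      ≡ 8 ℕ.* (1 ℕ.+ 4 ℕ.* h) ℕ.* (1 ℕ.+ 4 ℕ.* r) ℕ.* (m ℕ.* q)
    lemma = ℕ-solve-∀

-- Blocking sets and the bound for |A|² / pⁿ.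

module SizeBound (p : ℕ) (p-prime : Prime p) (2<p : 2 < p) (n : ℕ)
                 (h : ℕ) (p≡ : p ≡ suc (2 ℕ.* h)) where
  open import Data.Integer using (0ℤ; 1ℤ; _+_; _-_; _*_; -_)
  open ℕSum using (∑)
  open ModPrime p p-prime
  open SliceBound p p-prime using (sumOver; ∑-const; slice-bound; lowExponents)
  open PopularSums p p-prime 2<p n
  open PairReplacement p p-prime 2<p n
  open DecMembership _≟_ using (_∈?_)

  -- Unlike Zero, this is not affected by copies of x in R.
  ZeroAt : X → List X → Set
  ZeroAt x R = ∀ j → P ∣ ℤSum.∑ R (λ y → c j y - c j x)

  ZeroAt-++ : ∀ {x} R S → ZeroAt x R → ZeroAt x S → ZeroAt x (R ++ S)
  ZeroAt-++ R S zR zS j = subst (P ∣_) (sym (ℤSum.∑-++ R S _)) (∣m∣n⇒∣m+n (zR j) (zS j))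

  ∑-translate : ∀ j x L → ℤSum.∑ L (λ y → c j y - c j x) + + length L * c j x ≡ ℤSum.∑ L (c j)
  ∑-translate j x L = begin
    ℤSum.∑ L (λ y → c j y - c j x) + + length L * c j x
      ≡⟨ cong (λ t → ℤSum.∑ L (λ y → c j y - c j x) + t) (∑-const L (c j x)) ⟨
    ℤSum.∑ L (λ y → c j y - c j x) + ℤSum.∑ L (λ _ → c j x)
      ≡⟨ ℤSum.∑-distrib-+ L _ _ ⟨
    ℤSum.∑ L (λ y → c j y - c j x + c j x)
      ≡⟨ ℤSum.∑-cong L (λ {y} _ → cancel (c j y) (c j x)) ⟩
    ℤSum.∑ L (c j) ∎
    where
    open ≡-Reasoning
    cancel : ∀ a b → a - b + b ≡ a
    cancel = ℤ-solve-∀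

  P∣|L|* : ∀ {L : List X} j x → length L ≡ p → P ∣ + length L * c j x
  P∣|L|* {L} j x |L| = subst (λ m → P ∣ + m * c j x) (sym |L|) (∣m⇒∣m*n (c j x) ∣-refl)

  -- Translating p elements by `x` changes each coordinate sum by a multiple of p.
  ZeroAt⇒Zero : ∀ {x L} → length L ≡ p → ZeroAt x L → Zero L
  ZeroAt⇒Zero {x} {L} |L| z j = subst (P ∣_) (∑-translate j x L) (∣m∣n⇒∣m+n (z j) (P∣|L|* {L} j x |L|))

  Zero⇒ZeroAt : ∀ {x L} → length L ≡ p → Zero L → ZeroAt x L
  Zero⇒ZeroAt {x} {L} |L| z j = ∣m+n∣n⇒∣m (subst (P ∣_) (sym (∑-translate j x L)) (z j)) (P∣|L|* {L} j x |L|)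

  ZeroAt-self : ∀ {x} L → (∀ {y} → y ∈ L → y ≡ x) → ZeroAt x L
  ZeroAt-self {x} L h j = ∑-∣ L λ {y} y∈ → divides 0ℤ (trans (cong (λ z → c j z - c j x) (h y∈)) (ℤ.+-inverseʳ (c j x)))

  -- As p is 2h + 1, the bound `suc h` is (p+1)/2, exactly what `replace-pairs` asks for at m = h.
  Balanced : List X → Set
  Balanced O = length O ≡ p × Zero O × (∀ z → count z O ≤ suc h)

  -- The hitting set T(x), phrased contrapositively. The list `R` may repeat elements and so stands
  -- for a multiset.
  Blocks : List X → X → List X → Set
  Blocks B x T = ∀ R → R ≢ [] → length R ≤ h → (∀ {y} → y ∈ R → y ∈ B) → x ∉ R →
                 (∀ {y} → y ∈ R → y ∉ T) → ¬ ZeroAt x R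

  Outcome : List X → X → Set
  Outcome B x = (∃ λ O → (∀ {y} → y ∈ O → y ∈ B) × Balanced O) ⊎ (∃ λ T → length T ≤ h × Blocks B x T)

  ∈-replicate : ∀ {x y : X} m → y ∈ List.replicate m x → y ≡ x
  ∈-replicate (suc m) (here eq)  = eq
  ∈-replicate (suc m) (there y∈) = ∈-replicate m y∈

  count-++-disjoint : ∀ {R T b} → (∀ {y} → y ∈ R → y ∉ T) → (∀ z → count z R ≤ b) → (∀ z → count z T ≤ b) →
                      ∀ z → count z (R ++ T) ≤ b
  count-++-disjoint {R} {T} {b} disj cR cT z with z ∈? R
  ... | yes z∈R = subst (_≤ b) (sym (trans (count-++ z R T) (trans (cong (count z R ℕ.+_) (∉⇒count≡0 (disj z∈R))) (ℕ.+-identityʳ _)))) (cR z)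
  ... | no  z∉R = subst (_≤ b) (sym (trans (count-++ z R T) (cong (ℕ._+ count z T) (∉⇒count≡0 z∉R)))) (cT z)

  -- `T` is filled up to length p with copies of `x`, which add nothing to the sum of differences
  -- from `x`. Since `T` has at least `h` entries, at most h + 1 copies are needed.
  complete-cycle : ∀ {B x} T → x ∈ B → (∀ {y} → y ∈ T → y ∈ B) → x ∉ T → ZeroAt x T → (∀ z → count z T ≤ h) →
    h ≤ length T → length T ≤ p → ∃ λ O → (∀ {y} → y ∈ O → y ∈ B) × Balanced O
  complete-cycle {B} {x} T x∈B T⊆B x∉T zT cT h≤T T≤p =
    O , O⊆B , |O| ,
    ZeroAt⇒Zero {x} {O} |O| (ZeroAt-++ {x} xs T (ZeroAt-self {x} xs (∈-replicate m)) zT) ,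
    count-++-disjoint {xs} {T} disj
      (λ z → ℕ.≤-trans (count≤length z xs) (ℕ.≤-trans (ℕ.≤-reflexive (List.length-replicate m)) m≤))
      (λ z → ℕ.m≤n⇒m≤1+n (cT z))
    where
    m = p ∸ length T
    xs = List.replicate m x
    O = xs ++ T
    |O| : length O ≡ p
    |O| = trans (List.length-++ xs) (trans (cong (ℕ._+ length T) (List.length-replicate m)) (ℕ.m∸n+n≡m T≤p))
    O⊆B : ∀ {y} → y ∈ O → y ∈ B
    O⊆B y∈ with ∈-++⁻ xs y∈
    ... | inj₁ y∈xs = subst (_∈ B) (sym (∈-replicate m y∈xs)) x∈B
    ... | inj₂ y∈T  = T⊆B y∈T
    disj : ∀ {y} → y ∈ xs → y ∉ T
    disj y∈ = subst (_∉ T) (sym (∈-replicate m y∈)) x∉T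
    m≤ : m ≤ suc h
    m≤ = ℕ.≤-trans (ℕ.∸-monoʳ-≤ p h≤T)
      (ℕ.≤-reflexive (trans (cong (_∸ h) (trans p≡ (cong suc (cong (h ℕ.+_) (ℕ.+-identityʳ h))))) (ℕ.m+n∸n≡m (suc h) h)))

  -- Blocks of length ≤ h are collected until their total length lies between h and 2h.
  collect : ∀ {B x} → x ∈ B → ∀ fuel T → (∀ {y} → y ∈ T → y ∈ B) → x ∉ T → ZeroAt x T → (∀ z → count z T ≤ h) →
    length T < h → h ≤ length T ℕ.+ fuel → Outcome B x
  collect {B} {x} x∈B fuel T T⊆B x∉T zT cT T<h fuel≥
    -- A finite search: words of length at most `h` over the elements of `B` that are not `x` and
    -- not in `T`.
    with any? (λ R → ¬? (List.≡-dec _≟_ R []) ×-dec all? (λ j → P ∣? ℤSum.∑ R (λ y → c j y - c j x)))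
              (lists (filter (λ y → ¬? (y ≟ x) ×-dec ¬? (y ∈? T)) B) h)
  -- No further multiset avoids `T`, so `T` itself meets them all.
  ... | no none = inj₂ (T , ℕ.<⇒≤ T<h , λ R R≢[] R≤h R⊆B x∉R R∩T zR →
    none (lose (∈-lists⁺ R≤h λ {y} y∈ → ∈-filter⁺ _ (R⊆B y∈) ((λ y≡x → x∉R (subst (_∈ R) y≡x y∈)) , R∩T y∈)) (R≢[] , zR)))
  ... | yes found with R , R∈ , R≢[] , zR ← find found with R≤h , R⊆ ← ∈-lists⁻ h R∈ = continue fuel fuel≥
    where
    ok? = λ y → ¬? (y ≟ x) ×-dec ¬? (y ∈? T)
    R-props : ∀ {y} → y ∈ R → y ∈ B × y ≢ x × y ∉ T
    R-props y∈ = ∈-filter⁻ ok? {xs = B} (R⊆ y∈)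
    T′ = R ++ T
    T′⊆B : ∀ {y} → y ∈ T′ → y ∈ B
    T′⊆B y∈ with ∈-++⁻ R y∈
    ... | inj₁ y∈R = proj₁ (R-props y∈R)
    ... | inj₂ y∈T = T⊆B y∈T
    x∉T′ : x ∉ T′
    x∉T′ x∈ with ∈-++⁻ R x∈
    ... | inj₁ x∈R = proj₁ (proj₂ (R-props x∈R)) refl
    ... | inj₂ x∈T = x∉T x∈T
    -- `R` is disjoint from `T` and has length at most `h`, so no multiplicity exceeds `h`.
    cT′ : ∀ z → count z T′ ≤ h
    cT′ = count-++-disjoint {R} {T} (λ y∈ → proj₂ (proj₂ (R-props y∈))) (λ z → ℕ.≤-trans (count≤length z R) R≤h) cT
    1≤R : ∀ {R : List X} → R ≢ [] → 1 ≤ length R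
    1≤R {[]}    R≢[] = contradiction refl R≢[]
    1≤R {_ ∷ _} _    = s≤s z≤n
    T<T′ : length T < length T′
    T<T′ = subst (length T <_) (sym (List.length-++ R)) (ℕ.+-monoˡ-≤ (length T) (1≤R R≢[]))
    T′≤p : length T′ ≤ p
    T′≤p = begin
      length T′                  ≡⟨ List.length-++ R ⟩
      length R ℕ.+ length T      ≤⟨ ℕ.+-mono-≤ R≤h (ℕ.<⇒≤ T<h) ⟩
      h ℕ.+ h                    ≡⟨ cong (h ℕ.+_) (ℕ.+-identityʳ h) ⟨
      2 ℕ.* h                    ≤⟨ ℕ.n≤1+n _ ⟩
      suc (2 ℕ.* h)              ≡⟨ p≡ ⟨
      p                          ∎
      where open ℕ.≤-Reasoning
    continue : ∀ fuel → h ≤ length T ℕ.+ fuel → Outcome B x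
    -- The invariant `h ≤ length T + fuel` rules out this case. It survives each round because `R`
    -- is nonempty.
    continue zero       fuel≥ = contradiction (subst (h ≤_) (ℕ.+-identityʳ _) fuel≥) (ℕ.<⇒≱ T<h)
    continue (suc fuel) fuel≥ with length T′ ℕ.<? h
    ... | no  T′≮h = inj₁ (complete-cycle T′ x∈B T′⊆B x∉T′ (ZeroAt-++ {x} R T zR zT) cT′ (ℕ.≮⇒≥ T′≮h) T′≤p)
    ... | yes T′<h = collect x∈B fuel T′ T′⊆B x∉T′ (ZeroAt-++ {x} R T zR zT) cT′ T′<h
      (ℕ.≤-trans (subst (h ≤_) (ℕ.+-suc _ fuel) fuel≥) (ℕ.+-monoˡ-≤ fuel T<T′))

  0<h : 0 < h
  0<h = ℕ.n≢0⇒n>0 λ h≡0 → contradiction (trans p≡ (cong (λ h → suc (2 ℕ.* h)) h≡0)) (ℕ.>⇒≢ (ℕ.<-trans (ℕ.n<1+n 1) 2<p))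

  balanced-or-blocked : ∀ {B x} → x ∈ B → Outcome B x
  balanced-or-blocked x∈B = collect x∈B h [] (λ ()) (λ ()) (λ _ → divides 0ℤ refl) (λ _ → z≤n) 0<h ℕ.≤-refl

  tuple⇒list : ∀ {B : List X} (v : Vec X p) → (∀ i → lookup v i ∈ B) → (∀ j → P ∣ sumOver (c j) v) → (∀ x → v ≢ replicate p x) →
    ∃ λ L → (∀ {y} → y ∈ L → y ∈ B) × length L ≡ p × Zero L × (∀ x → ∃ λ y → y ∈ L × y ≢ x)
  tuple⇒list {B} v v∈B zv v≢ = L , L⊆B , |L| , (λ j → subst (P ∣_) (sym (ℤSum.∑-map (lookup v) (allFin p) (c j))) (zv j)) , other
    where
    L = map (lookup v) (allFin p)
    |L| : length L ≡ p
    |L| = trans (List.length-map (lookup v) (allFin p)) (List.length-tabulate {n = p} (λ i → i))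
    L⊆B : ∀ {y} → y ∈ L → y ∈ B
    L⊆B y∈ with i , _ , refl ← ∈-map⁻ (lookup v) y∈ = v∈B i
    other : ∀ x → ∃ λ y → y ∈ L × y ≢ x
    other x with any? (λ y → ¬? (y ≟ x)) L
    ... | yes found = find found
    ... | no none = contradiction (trans (sym (tabulate∘lookup v)) (trans
      (tabulate-cong λ i → trans
        (decidable-stable (lookup v i ≟ x) λ ≢x → none (lose (∈-map⁺ (lookup v) (∈-allFin i)) ≢x))
        (sym (lookup-replicate i x)))
      (tabulate∘lookup (replicate p x)))) (v≢ x)

  -- If `x` occurred more than h + 1 times, the entries other than `x` would form a list of length
  -- at most `h`, nonempty because `L` is not constant. Copies of `x` do not affect `ZeroAt x`, so
  -- this list would be zero at `x` while avoiding `T x`.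
  unblocked⇒balanced : ∀ {B L} (T : X → List X) → (∀ {x} → x ∈ B → Blocks B x (T x)) →
    (∀ {y} → y ∈ L → y ∈ B) → (∀ {x y} → x ∈ L → y ∈ L → x ≢ y → y ∉ T x) →
    length L ≡ p → Zero L → (∀ x → ∃ λ y → y ∈ L × y ≢ x) → Balanced L
  unblocked⇒balanced {B} {L} T blocks L⊆B free |L| zL other = |L| , zL , bound
    where
    bound : ∀ x → count x L ≤ suc h
    bound x with count x L ℕ.≤? suc h
    ... | yes ≤ = ≤
    ... | no  ≰ = contradiction zR (blocks (L⊆B x∈L) R R≢[] R≤h (L⊆B ∘ R⊆L) x∉R λ y∈ → free x∈L (R⊆L y∈) (y≢x y∈ ∘ sym))
      where
      R = filter (¬? ∘ (x ≟_)) L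
      R⊆L : ∀ {y} → y ∈ R → y ∈ L
      R⊆L y∈ = proj₁ (∈-filter⁻ (¬? ∘ (x ≟_)) {xs = L} y∈)
      y≢x : ∀ {y} → y ∈ R → y ≢ x
      y≢x y∈ = proj₂ (∈-filter⁻ (¬? ∘ (x ≟_)) {xs = L} y∈) ∘ sym
      x∉R : x ∉ R
      x∉R x∈ = y≢x x∈ refl
      x∈L : x ∈ L
      x∈L = decidable-stable (x ∈? L) λ x∉ → ≰ (subst (_≤ suc h) (sym (∉⇒count≡0 x∉)) z≤n)
      R≢[] : R ≢ []
      R≢[] R≡[] with y , y∈ , y≢x ← other x = contradiction (subst (y ∈_) R≡[] (∈-filter⁺ (¬? ∘ (x ≟_)) y∈ (y≢x ∘ sym))) λ ()
      R≤h : length R ≤ h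
      R≤h = ℕ.+-cancelˡ-≤ (suc h) (length R) h (begin
        suc h ℕ.+ length R            ≤⟨ ℕ.+-monoˡ-≤ (length R) (ℕ.<⇒≤ (ℕ.≰⇒> ≰)) ⟩
        count x L ℕ.+ length R        ≡⟨ cong (ℕ._+ length R) (count-filter x L) ⟩
        length (filter (x ≟_) L) ℕ.+ length R ≡⟨ length-partition (x ≟_) L ⟨
        length L                      ≡⟨ trans |L| p≡ ⟩
        suc (2 ℕ.* h)                 ≡⟨ cong (λ k → suc (h ℕ.+ k)) (ℕ.+-identityʳ h) ⟩
        suc h ℕ.+ h                   ∎)
        where open ℕ.≤-Reasoning
      zR : ZeroAt x R
      zR j = ∣m+n∣m⇒∣n (subst (P ∣_) (ℤSum.∑-partition (x ≟_) L _) (Zero⇒ZeroAt {x} {L} |L| zL j))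
        (ZeroAt-self {x} (filter (x ≟_) L) (λ y∈ → sym (proj₂ (∈-filter⁻ (x ≟_) {xs = L} y∈))) j)

  module _ (A : List X) (A-unique : Unique A)
           (no-distinct : ∀ L → Unique L → (∀ {x} → x ∈ L → x ∈ A) → length L ≡ p → ¬ Zero L) where

    M : ℕ
    M = length (lowExponents n)

    module PopularClique (B : List X) (B-unique : Unique B) (B⊆A : ∀ {x} → x ∈ B → x ∈ A)
             (popular : ∀ {x y} → x ∈ B → y ∈ B → x ≢ y → ¬ Unpopular A A-unique x y) where

      -- Starting with no fresh elements, `replace-pairs` would turn `O` into p distinct elements of
      -- `A` with sum 0.
      no-balanced : ∀ {O} → (∀ {x} → x ∈ O → x ∈ B) → ¬ Balanced O
      no-balanced {O} O⊆B (|O| , zO , count≤) with L , uL , L⊆A , |L| , zL ←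
        replace-pairs A A-unique B B⊆A popular h O [] (trans |O| p≡) O⊆B count≤ [] (λ ()) (λ ())
          (trans (ℕ.+-identityʳ _) |O|) (λ j → subst (λ L → P ∣ ℤSum.∑ L (c j)) (sym (List.++-identityʳ O)) (zO j)) =
        no-distinct L uL L⊆A |L| zL

      blocker : ∀ {x} → x ∈ B → ∃ λ T → length T ≤ h × Blocks B x T
      blocker x∈B with balanced-or-blocked x∈B
      ... | inj₁ (O , O⊆B , bal) = contradiction bal (no-balanced O⊆B)
      ... | inj₂ blocked         = blocked

      blockers : X → List X
      blockers x with x ∈? B
      ... | yes x∈B = proj₁ (blocker x∈B)
      -- A default value; only members of `B` are ever compared.
      ... | no  _   = []

      |blockers|≤h : ∀ x → length (blockers x) ≤ h
      |blockers|≤h x with x ∈? B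
      ... | yes x∈B = proj₁ (proj₂ (blocker x∈B))
      ... | no  _   = z≤n

      blockers-block : ∀ {x} → x ∈ B → Blocks B x (blockers x)
      blockers-block {x} x∈B with x ∈? B
      ... | yes x∈B = proj₂ (proj₂ (blocker x∈B))
      ... | no  x∉B = contradiction x∈B x∉B

      open IndependentSet (λ x y → y ∈? blockers x) using (turán)

      -- Each `x` has at most `h` blockers, and each of these occurs at most once in `B`.
      few-blocked : ∑ B (λ x → ∑ B (λ y → 𝟙 (y ∈? blockers x))) ≤ length B ℕ.* h
      few-blocked = ∑-upper B λ {x} _ → ℕ.≤-trans (∑𝟙∈≤length (blockers x)) (|blockers|≤h x)
        where
        ∑𝟙∈≤length : ∀ T → ∑ B (λ y → 𝟙 (y ∈? T)) ≤ length T
        ∑𝟙∈≤length T = begin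
          ∑ B (λ y → 𝟙 (y ∈? T))                ≤⟨ ∑-mono B (λ {y} _ → split y (y ∈? T)) ⟩
          ∑ B (λ y → ∑ T (λ t → 𝟙 (y ≟ t)))     ≡⟨ ℕSum.∑-swap B T _ ⟩
          ∑ T (λ t → ∑ B (λ y → 𝟙 (y ≟ t)))
            ≤⟨ ∑-upper T (λ {t} _ → ∑𝟙≤1 (_≟ t) B-unique (λ { _ _ refl refl → refl })) ⟩
          length T ℕ.* 1                        ≡⟨ ℕ.*-identityʳ _ ⟩
          length T                              ∎
          where
          open ℕ.≤-Reasoning
          split : ∀ y (d : Dec (y ∈ T)) → 𝟙 d ≤ ∑ T (λ t → 𝟙 (y ≟ t))
          split y (no _)    = z≤n
          split y (yes y∈T) = ℕ.≤-trans (ℕ.≤-reflexive (sym (𝟙-true (y ≟ y) refl))) (∈⇒≤∑ (λ t → 𝟙 (y ≟ t)) y∈T)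

      -- A larger `I` would contain a nonconstant zero-sum tuple by `slice-bound`; independence
      -- makes it balanced, which `no-balanced` excludes.
      small-independent : ∀ {I} → Unique I → (∀ {x} → x ∈ I → x ∈ B) →
        (∀ {x y} → x ∈ I → y ∈ I → x ≢ y → y ∉ blockers x) → length I ≤ M ℕ.+ M
      small-independent {I} uI I⊆B indep = ℕ.≮⇒≥ λ 2M<I →
        let v , v∈ , zv , v≢ = slice-bound _≟_ c I uI 2M<I
            L , L⊆I , |L| , zL , other = tuple⇒list v v∈ zv v≢
        in no-balanced (I⊆B ∘ L⊆I)
             (unblocked⇒balanced blockers blockers-block (I⊆B ∘ L⊆I) (λ x∈ y∈ → indep (L⊆I x∈) (L⊆I y∈)) |L| zL other)

      clique-bound : length B ≤ 4 ℕ.* M ℕ.* (1 ℕ.+ 4 ℕ.* h)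
      clique-bound =
        let I , uI , I⊆B , indep , bound = turán B B-unique (length B ℕ.* h) few-blocked
        in cancel-size (length B) (length I) M h (small-independent uI I⊆B indep) bound

    -- Turán for the relation `Unpopular` supplies `B`; `clique-bound`, a second use of Turán inside
    -- `B`, limits its size.
    size-bound : length A ℕ.* length A ≤ 8 ℕ.* (1 ℕ.+ 4 ℕ.* h) ℕ.* (1 ℕ.+ 4 ℕ.* r) ℕ.* (M ℕ.* p ℕ.^ n)
    size-bound =
      let B , uB , B⊆A , popular , bound =
            IndependentSet.turán (unpopular? A A-unique) A A-unique (p ℕ.^ n ℕ.* r) (few-unpopular A A-unique)
      in combine (length A) (length B) M h (p ℕ.^ n) r
           bound (PopularClique.clique-bound B uB B⊆A popular) (|A|≤ A A-unique)

-- Rational inequalities and the generating function of the degree.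

module RationalBounds where
  open import Data.Rational using (0ℚ; 1ℚ; ½; _+_; _*_; toℚᵘ)
  open ℚSum

  -- Casts are compared as unnormalised fractions with denominator 1, where their arithmetic is that
  -- of ℤ.
  toℚᵘ-ℕ→ℚ : ∀ m → toℚᵘ (ℕ→ℚ m) ℚᵘ.≃ ℚᵘ.mkℚᵘ (+ m) 0
  toℚᵘ-ℕ→ℚ m = ℚ.toℚᵘ-fromℚᵘ (ℚᵘ.mkℚᵘ (+ m) 0)

  ℕ→ℚ-* : ∀ a b → ℕ→ℚ (a ℕ.* b) ≡ ℕ→ℚ a * ℕ→ℚ b
  ℕ→ℚ-* a b = ℚ.toℚᵘ-injective (begin
    toℚᵘ (ℕ→ℚ (a ℕ.* b))                      ≈⟨ toℚᵘ-ℕ→ℚ (a ℕ.* b) ⟩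
    ℚᵘ.mkℚᵘ (+ (a ℕ.* b)) 0                   ≡⟨ cong (λ z → ℚᵘ.mkℚᵘ z 0) (ℤ.pos-* a b) ⟩
    ℚᵘ.mkℚᵘ (+ a) 0 ℚᵘ.* ℚᵘ.mkℚᵘ (+ b) 0      ≈⟨ ℚᵘ.*-cong (toℚᵘ-ℕ→ℚ a) (toℚᵘ-ℕ→ℚ b) ⟨
    toℚᵘ (ℕ→ℚ a) ℚᵘ.* toℚᵘ (ℕ→ℚ b)            ≈⟨ ℚ.toℚᵘ-homo-* (ℕ→ℚ a) (ℕ→ℚ b) ⟨
    toℚᵘ (ℕ→ℚ a * ℕ→ℚ b)                      ∎)
    where open import Relation.Binary.Reasoning.Setoid ℚᵘ.≃-setoid

  ℕ→ℚ-suc : ∀ m → ℕ→ℚ (suc m) ≡ 1ℚ + ℕ→ℚ m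
  ℕ→ℚ-suc m = ℚ.toℚᵘ-injective (begin
    toℚᵘ (ℕ→ℚ (suc m))                        ≈⟨ toℚᵘ-ℕ→ℚ (suc m) ⟩
    ℚᵘ.mkℚᵘ (+ suc m) 0                       ≡⟨ cong (λ z → ℚᵘ.mkℚᵘ (ℤ.suc z) 0) (ℤ.*-identityʳ (+ m)) ⟨
    ℚᵘ.1ℚᵘ ℚᵘ.+ ℚᵘ.mkℚᵘ (+ m) 0               ≈⟨ ℚᵘ.+-congʳ ℚᵘ.1ℚᵘ (toℚᵘ-ℕ→ℚ m) ⟨
    toℚᵘ 1ℚ ℚᵘ.+ toℚᵘ (ℕ→ℚ m)                 ≈⟨ ℚ.toℚᵘ-homo-+ 1ℚ (ℕ→ℚ m) ⟨
    toℚᵘ (1ℚ + ℕ→ℚ m)                         ∎)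
    where open import Relation.Binary.Reasoning.Setoid ℚᵘ.≃-setoid

  ℕ→ℚ-mono-< : ∀ {a b} → a ℕ.< b → ℕ→ℚ a ℚ.< ℕ→ℚ b
  ℕ→ℚ-mono-< {a} {b} a<b = ℚ.toℚᵘ-cancel-<
    (ℚᵘ.<-respˡ-≃ (ℚᵘ.≃-sym (toℚᵘ-ℕ→ℚ a)) (ℚᵘ.<-respʳ-≃ (ℚᵘ.≃-sym (toℚᵘ-ℕ→ℚ b))
      (ℚᵘ.*<* (subst₂ ℤ._<_ (sym (ℤ.*-identityʳ (+ a))) (sym (ℤ.*-identityʳ (+ b))) (ℤ.+<+ a<b)))))

  ℕ→ℚ-mono-≤ : ∀ {a b} → a ℕ.≤ b → ℕ→ℚ a ℚ.≤ ℕ→ℚ b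
  ℕ→ℚ-mono-≤ {a} {b} a≤b = ℚ.toℚᵘ-cancel-≤
    (ℚᵘ.≤-respˡ-≃ (ℚᵘ.≃-sym (toℚᵘ-ℕ→ℚ a)) (ℚᵘ.≤-respʳ-≃ (ℚᵘ.≃-sym (toℚᵘ-ℕ→ℚ b))
      (ℚᵘ.*≤* (subst₂ ℤ._≤_ (sym (ℤ.*-identityʳ (+ a))) (sym (ℤ.*-identityʳ (+ b))) (ℤ.+≤+ a≤b)))))

  0≤ℕ→ℚ : ∀ m → 0ℚ ℚ.≤ ℕ→ℚ m
  0≤ℕ→ℚ m = ℕ→ℚ-mono-≤ {0} {m} z≤n

  ℕ-*-^ : ∀ a b k → (a ℕ.* b) ℕ.^ k ≡ a ℕ.^ k ℕ.* b ℕ.^ k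
  ℕ-*-^ a b zero    = refl
  ℕ-*-^ a b (suc k) = trans (cong (a ℕ.* b ℕ.*_) (ℕ-*-^ a b k)) (ℕ.[m*n]*[o*p]≡[m*o]*[n*p] a b (a ℕ.^ k) (b ℕ.^ k))

  *-mono-≤₀ : ∀ {a b c d} → 0ℚ ℚ.≤ c → 0ℚ ℚ.≤ b → a ℚ.≤ b → c ℚ.≤ d → a * c ℚ.≤ b * d
  *-mono-≤₀ {a} {b} {c} {d} 0≤c 0≤b a≤b c≤d = ℚ.≤-trans
    (ℚ.*-monoʳ-≤-nonNeg c {{ℚ.nonNegative 0≤c}} a≤b)
    (ℚ.*-monoˡ-≤-nonNeg b {{ℚ.nonNegative 0≤b}} c≤d)

  0≤* : ∀ {a b} → 0ℚ ℚ.≤ a → 0ℚ ℚ.≤ b → 0ℚ ℚ.≤ a * b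
  0≤* {a} {b} 0≤a 0≤b = subst (ℚ._≤ a * b) (ℚ.*-zeroˡ b) (ℚ.*-monoʳ-≤-nonNeg b {{ℚ.nonNegative 0≤b}} 0≤a)

  0≤1 : 0ℚ ℚ.≤ 1ℚ
  0≤1 = ℚ.nonNegative⁻¹ 1ℚ

  0≤^ : ∀ {t} k → 0ℚ ℚ.≤ t → 0ℚ ℚ.≤ t ^ℚ k
  0≤^ zero    0≤t = 0≤1
  0≤^ (suc k) 0≤t = 0≤* 0≤t (0≤^ k 0≤t)

  ^ℚ-+ : ∀ t a b → t ^ℚ (a ℕ.+ b) ≡ t ^ℚ a * t ^ℚ b
  ^ℚ-+ t zero    b = sym (ℚ.*-identityˡ _)
  ^ℚ-+ t (suc a) b = trans (cong (t *_) (^ℚ-+ t a b)) (sym (ℚ.*-assoc t _ _))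

  ^ℚ-* : ∀ t a b → t ^ℚ (b ℕ.* a) ≡ (t ^ℚ a) ^ℚ b
  ^ℚ-* t a zero    = refl
  ^ℚ-* t a (suc b) = trans (^ℚ-+ t a (b ℕ.* a)) (cong (t ^ℚ a *_) (^ℚ-* t a b))

  *-^ℚ : ∀ x y k → (x * y) ^ℚ k ≡ x ^ℚ k * y ^ℚ k
  *-^ℚ x y zero    = refl
  *-^ℚ x y (suc k) = trans (cong (x * y *_) (*-^ℚ x y k)) (interchange x y (x ^ℚ k) (y ^ℚ k))
    where open import Algebra.Properties.CommutativeSemigroup (CommutativeRing.*-commutativeSemigroup ℚ.+-*-commutativeRing) using (interchange)

  ^ℚ-mono : ∀ {x y} k → 0ℚ ℚ.≤ x → x ℚ.≤ y → x ^ℚ k ℚ.≤ y ^ℚ k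
  ^ℚ-mono zero    0≤x x≤y = ℚ.≤-refl
  ^ℚ-mono (suc k) 0≤x x≤y = *-mono-≤₀ (0≤^ k 0≤x) (ℚ.≤-trans 0≤x x≤y) x≤y (^ℚ-mono k 0≤x x≤y)

  1^ℚ : ∀ k → 1ℚ ^ℚ k ≡ 1ℚ
  1^ℚ zero    = refl
  1^ℚ (suc k) = trans (ℚ.*-identityˡ _) (1^ℚ k)

  ^ℚ-antitone : ∀ {t a b} → 0ℚ ℚ.≤ t → t ℚ.≤ 1ℚ → a ℕ.≤ b → t ^ℚ b ℚ.≤ t ^ℚ a
  ^ℚ-antitone {t} {a} {b} 0≤t t≤1 a≤b = begin
    t ^ℚ b                      ≡⟨ cong (t ^ℚ_) (ℕ.m+[n∸m]≡n a≤b) ⟨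
    t ^ℚ (a ℕ.+ (b ℕ.∸ a))      ≡⟨ ^ℚ-+ t a (b ℕ.∸ a) ⟩
    t ^ℚ a * t ^ℚ (b ℕ.∸ a)
      ≤⟨ ℚ.*-monoˡ-≤-nonNeg (t ^ℚ a) {{ℚ.nonNegative (0≤^ a 0≤t)}} (^ℚ-mono (b ℕ.∸ a) 0≤t t≤1) ⟩
    t ^ℚ a * 1ℚ ^ℚ (b ℕ.∸ a)    ≡⟨ cong (t ^ℚ a *_) (1^ℚ (b ℕ.∸ a)) ⟩
    t ^ℚ a * 1ℚ                 ≡⟨ ℚ.*-identityʳ _ ⟩
    t ^ℚ a                      ∎
    where open ℚ.≤-Reasoning

  ℕ→ℚ-^ : ∀ a k → ℕ→ℚ (a ℕ.^ k) ≡ ℕ→ℚ a ^ℚ k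
  ℕ→ℚ-^ a zero    = refl
  ℕ→ℚ-^ a (suc k) = trans (ℕ→ℚ-* a (a ℕ.^ k)) (cong (ℕ→ℚ a *_) (ℕ→ℚ-^ a k))

  ∑ℚ-mono : (L : List A) {f g : A → ℚ} → (∀ {x} → x ∈ L → f x ℚ.≤ g x) → ∑ L f ℚ.≤ ∑ L g
  ∑ℚ-mono []      h = ℚ.≤-refl
  ∑ℚ-mono (x ∷ L) h = ℚ.+-mono-≤ (h (here refl)) (∑ℚ-mono L (h ∘ there))

  ∑ℚ-const : (L : List A) (a : ℚ) → ∑ L (λ _ → a) ≡ ℕ→ℚ (length L) * a
  ∑ℚ-const []      a = sym (ℚ.*-zeroˡ a)
  ∑ℚ-const (x ∷ L) a = begin
    a + ∑ L (λ _ → a)                ≡⟨ cong₂ _+_ (sym (ℚ.*-identityˡ a)) (∑ℚ-const L a) ⟩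
    1ℚ * a + ℕ→ℚ (length L) * a      ≡⟨ ℚ.*-distribʳ-+ a 1ℚ (ℕ→ℚ (length L)) ⟨
    (1ℚ + ℕ→ℚ (length L)) * a        ≡⟨ cong (_* a) (ℕ→ℚ-suc (length L)) ⟨
    ℕ→ℚ (suc (length L)) * a         ∎
    where open ≡-Reasoning

  ∑-allFin-^ : ∀ t k → ∑ (allFin k) (λ a → t ^ℚ toℕ a) ≡ geom t k
  ∑-allFin-^ t zero    = refl
  ∑-allFin-^ t (suc k) = cong (λ z → 1ℚ + z) (begin
    ∑ (List.tabulate {n = k} suc) (λ a → t ^ℚ toℕ a)
      ≡⟨ cong (λ L → ∑ L (λ a → t ^ℚ toℕ a)) (List.map-tabulate {n = k} (λ i → i) suc) ⟨
    ∑ (map suc (allFin k)) (λ a → t ^ℚ toℕ a) ≡⟨ ∑-map suc (allFin k) _ ⟩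
    ∑ (allFin k) (λ a → t * t ^ℚ toℕ a)       ≡⟨ *-distribˡ-∑ (allFin k) t _ ⟨
    t * ∑ (allFin k) (λ a → t ^ℚ toℕ a)       ≡⟨ cong (t *_) (∑-allFin-^ t k) ⟩
    t * geom t k                              ∎)
    where open ≡-Reasoning

  ∏-const : ∀ k t → ∏ {k} (λ _ → t) ≡ t ^ℚ k
  ∏-const zero    t = refl
  ∏-const (suc k) t = cong (t *_) (∏-const k t)

  ∏-^ℚ : ∀ {k} t (e : Fin k → ℕ) → ∏ (λ j → t ^ℚ e j) ≡ t ^ℚ sumFin e
  ∏-^ℚ {zero}  t e = refl
  ∏-^ℚ {suc k} t e = trans (cong (t ^ℚ e zero *_) (∏-^ℚ t (e ∘ suc))) (sym (^ℚ-+ t (e zero) _))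

  geom-nonneg : ∀ {t} k → 0ℚ ℚ.≤ t → 0ℚ ℚ.≤ geom t k
  geom-nonneg zero    0≤t = ℚ.≤-refl
  geom-nonneg (suc k) 0≤t = ℚ.+-mono-≤ 0≤1 (0≤* 0≤t (geom-nonneg k 0≤t))

  -- 2 is the fixed point of the recursion that sends y to 1 + y/2.
  geom-½≤2 : ∀ k → geom ½ k ℚ.≤ ℕ→ℚ 2
  geom-½≤2 zero    = 0≤ℕ→ℚ 2
  geom-½≤2 (suc k) = ℚ.+-monoʳ-≤ 1ℚ (ℚ.*-monoˡ-≤-nonNeg ½ (geom-½≤2 k))

  module _ (p : ℕ) (p-prime : Prime p) (n : ℕ) where
    open SliceBound p p-prime

    -- The generating function of the degree factors over the n coordinates.
    ∑-^-degree : ∀ t → ∑ (vecs (allFin p) n) (λ ε → t ^ℚ degree ε) ≡ geom t p ^ℚ n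
    ∑-^-degree t = begin
      ∑ (vecs (allFin p) n) (λ ε → t ^ℚ degree ε)
        ≡⟨ ∑-cong (vecs (allFin p) n) (λ {ε} _ → ∏-^ℚ t (toℕ ∘ lookup ε)) ⟨
      ∑ (vecs (allFin p) n) (λ ε → ∏ (λ j → t ^ℚ toℕ (lookup ε j)))
        ≡⟨ ∑-vecs-∏ (allFin p) n (λ _ a → t ^ℚ toℕ a) ⟩
      ∏ {n} (λ _ → ∑ (allFin p) (λ a → t ^ℚ toℕ a))
        ≡⟨ ∏-const n _ ⟩
      ∑ (allFin p) (λ a → t ^ℚ toℕ a) ^ℚ n
        ≡⟨ cong (_^ℚ n) (∑-allFin-^ t p) ⟩
      geom t p ^ℚ n ∎
      where open ≡-Reasoning

    -- Degrees are integers, so low ones are at most `D`, the floor of n(p-1)/p. As t ≤ 1, each low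
    -- exponent vector contributes at least t^D to the generating function, which gives M t^D ≤
    -- (geom t p)^n. The p-th power of this suffices because p D ≤ n(p-1).
    lowExponents-bound : ∀ t → 0ℚ ℚ.≤ t → t ℚ.≤ 1ℚ →
      ℕ→ℚ (length (lowExponents n) ℕ.^ p) * t ^ℚ (n ℕ.* (p ℕ.∸ 1)) ℚ.≤ geom t p ^ℚ (n ℕ.* p)
    lowExponents-bound t 0≤t t≤1 = begin
      ℕ→ℚ (M ℕ.^ p) * t ^ℚ N
        ≤⟨ ℚ.*-monoˡ-≤-nonNeg (ℕ→ℚ (M ℕ.^ p)) {{ℚ.nonNegative (0≤ℕ→ℚ (M ℕ.^ p))}}
             (^ℚ-antitone 0≤t t≤1 (subst (ℕ._≤ N) (ℕ.*-comm D p) (ℕ.m/n*n≤m N p))) ⟩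
      ℕ→ℚ (M ℕ.^ p) * t ^ℚ (p ℕ.* D)  ≡⟨ cong₂ _*_ (ℕ→ℚ-^ M p) (^ℚ-* t D p) ⟩
      ℕ→ℚ M ^ℚ p * (t ^ℚ D) ^ℚ p      ≡⟨ *-^ℚ (ℕ→ℚ M) (t ^ℚ D) p ⟨
      (ℕ→ℚ M * t ^ℚ D) ^ℚ p           ≤⟨ ^ℚ-mono p (0≤* (0≤ℕ→ℚ M) (0≤^ D 0≤t)) first-power ⟩
      (geom t p ^ℚ n) ^ℚ p            ≡⟨ ^ℚ-* (geom t p) n p ⟨
      geom t p ^ℚ (p ℕ.* n)           ≡⟨ cong (geom t p ^ℚ_) (ℕ.*-comm p n) ⟩
      geom t p ^ℚ (n ℕ.* p)           ∎
      where
      open ℚ.≤-Reasoning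
      M = length (lowExponents n)
      N = n ℕ.* (p ℕ.∸ 1)
      D = N ℕ./ p
      low? = λ (ε : Vec (Fin p) n) → p ℕ.* degree ε ℕ.≤? N
      degree≤D : ∀ {ε} → ε ∈ lowExponents n → degree ε ℕ.≤ D
      degree≤D {ε} ε∈ = subst (ℕ._≤ D) (ℕ.m*n/n≡m (degree ε) p) (ℕ./-monoˡ-≤ p
        (subst (ℕ._≤ N) (ℕ.*-comm p (degree ε)) (proj₂ (∈-filter⁻ low? {xs = vecs (allFin p) n} ε∈))))
      first-power : ℕ→ℚ M * t ^ℚ D ℚ.≤ geom t p ^ℚ n
      first-power = begin
        ℕ→ℚ M * t ^ℚ D
          ≡⟨ ∑ℚ-const (lowExponents n) (t ^ℚ D) ⟨
        ∑ (lowExponents n) (λ _ → t ^ℚ D)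
          ≤⟨ ∑ℚ-mono (lowExponents n) (λ ε∈ → ^ℚ-antitone 0≤t t≤1 (degree≤D ε∈)) ⟩
        ∑ (lowExponents n) (λ ε → t ^ℚ degree ε)
          ≡⟨ ℚ.+-identityʳ _ ⟨
        ∑ (lowExponents n) (λ ε → t ^ℚ degree ε) + 0ℚ
          ≤⟨ ℚ.+-monoʳ-≤ (∑ (lowExponents n) (λ ε → t ^ℚ degree ε)) (nonneg (filter (¬? ∘ low?) (vecs (allFin p) n))) ⟩
        ∑ (lowExponents n) (λ ε → t ^ℚ degree ε) + ∑ (filter (¬? ∘ low?) (vecs (allFin p) n)) (λ ε → t ^ℚ degree ε)
          ≡⟨ ∑-partition low? (vecs (allFin p) n) _ ⟨
        ∑ (vecs (allFin p) n) (λ ε → t ^ℚ degree ε)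
          ≡⟨ ∑-^-degree t ⟩
        geom t p ^ℚ n ∎
        where
        nonneg : ∀ L → 0ℚ ℚ.≤ ∑ L (λ ε → t ^ℚ degree {n} ε)
        nonneg L = subst (ℚ._≤ ∑ L (λ ε → t ^ℚ degree ε)) (∑-zero L) (∑ℚ-mono L (λ {ε} _ → 0≤^ (degree ε) 0≤t))

    -- The p-th power of the hypothesis, combined with the generating function bound for `M ^ p`.
    bound-γ : ∀ C .{{_ : NonZero C}} m → m ℕ.* m ℕ.≤ C ℕ.* (length (lowExponents n) ℕ.* p ℕ.^ n) → BoundSqrtGammaP p C n m
    bound-γ C m m²≤ t 0<t t<1 = begin
      ℕ→ℚ (m ℕ.^ (2 ℕ.* p)) * T
        ≤⟨ ℚ.*-monoʳ-≤-nonNeg T {{ℚ.nonNegative 0≤T}} (ℕ→ℚ-mono-≤ powers≤) ⟩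
      ℕ→ℚ (C ℕ.^ (2 ℕ.* p) ℕ.* p ℕ.^ (n ℕ.* p) ℕ.* M ℕ.^ p) * T  ≡⟨ cong (_* T) (ℕ→ℚ-* W (M ℕ.^ p)) ⟩
      ℕ→ℚ W * ℕ→ℚ (M ℕ.^ p) * T                                ≡⟨ ℚ.*-assoc (ℕ→ℚ W) (ℕ→ℚ (M ℕ.^ p)) T ⟩
      ℕ→ℚ W * (ℕ→ℚ (M ℕ.^ p) * T)
        ≤⟨ ℚ.*-monoˡ-≤-nonNeg (ℕ→ℚ W) {{ℚ.nonNegative (0≤ℕ→ℚ W)}} (lowExponents-bound t (ℚ.<⇒≤ 0<t) (ℚ.<⇒≤ t<1)) ⟩
      ℕ→ℚ W * geom t p ^ℚ (n ℕ.* p)                            ∎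
      where
      M = length (lowExponents n)
      T = t ^ℚ (n ℕ.* (p ℕ.∸ 1))
      W = C ℕ.^ (2 ℕ.* p) ℕ.* p ℕ.^ (n ℕ.* p)
      0≤T : 0ℚ ℚ.≤ T
      0≤T = 0≤^ (n ℕ.* (p ℕ.∸ 1)) (ℚ.<⇒≤ 0<t)
      powers≤ : m ℕ.^ (2 ℕ.* p) ℕ.≤ W ℕ.* M ℕ.^ p
      powers≤ = begin
        m ℕ.^ (2 ℕ.* p)                                 ≡⟨ ℕ.^-*-assoc m 2 p ⟨
        (m ℕ.^ 2) ℕ.^ p                                 ≡⟨ cong (λ k → (m ℕ.* k) ℕ.^ p) (ℕ.*-identityʳ m) ⟩
        (m ℕ.* m) ℕ.^ p                                 ≤⟨ ℕ.^-monoˡ-≤ p m²≤ ⟩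
        (C ℕ.* (M ℕ.* p ℕ.^ n)) ℕ.^ p
          ≡⟨ trans (ℕ-*-^ C (M ℕ.* p ℕ.^ n) p) (cong (C ℕ.^ p ℕ.*_) (ℕ-*-^ M (p ℕ.^ n) p)) ⟩
        -- The square root of `C` would do as the constant; since `C` is at least 1, C^p may be
        -- enlarged to C^(2p).
        C ℕ.^ p ℕ.* (M ℕ.^ p ℕ.* (p ℕ.^ n) ℕ.^ p)       ≤⟨ ℕ.*-monoˡ-≤ _ (ℕ.^-monoʳ-≤ C (ℕ.m≤n*m p 2)) ⟩
        C ℕ.^ (2 ℕ.* p) ℕ.* (M ℕ.^ p ℕ.* (p ℕ.^ n) ℕ.^ p)
          ≡⟨ cong (λ k → C ℕ.^ (2 ℕ.* p) ℕ.* k) (trans (ℕ.*-comm (M ℕ.^ p) _) (cong (ℕ._* M ℕ.^ p) (ℕ.^-*-assoc p n p))) ⟩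
        C ℕ.^ (2 ℕ.* p) ℕ.* (p ℕ.^ (n ℕ.* p) ℕ.* M ℕ.^ p) ≡⟨ ℕ.*-assoc (C ℕ.^ (2 ℕ.* p)) (p ℕ.^ (n ℕ.* p)) (M ℕ.^ p) ⟨
        W ℕ.* M ℕ.^ p                                   ∎
        where open ℕ.≤-Reasoning
      open ℚ.≤-Reasoning

    -- At t = 1/2 the geometric sum is at most 2, and 4^(np) (1/2)^(n(p-1)) equals 2^(np) 2^n. The
    -- factor 2^n exceeds 1 because n > 0, which gives strictness.
    γ<4 : ∀ C .{{_ : NonZero C}} → 0 ℕ.< n → SqrtGammaP<2SqrtP p C n
    γ<4 C 0<n = ½ , ℚ.positive⁻¹ ½ , ½<1 , (begin-strict
      ℕ→ℚ W * geom ½ p ^ℚ (n ℕ.* p)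
        ≤⟨ ℚ.*-monoˡ-≤-nonNeg (ℕ→ℚ W) {{ℚ.nonNegative (0≤ℕ→ℚ W)}}
           (^ℚ-mono (n ℕ.* p) (geom-nonneg p (ℚ.nonNegative⁻¹ ½)) (geom-½≤2 p)) ⟩
      ℕ→ℚ W * ℕ→ℚ 2 ^ℚ (n ℕ.* p)
        ≡⟨ trans (cong (ℕ→ℚ W *_) (sym (ℕ→ℚ-^ 2 (n ℕ.* p)))) (sym (ℕ→ℚ-* W (2 ℕ.^ (n ℕ.* p)))) ⟩
      ℕ→ℚ (W ℕ.* 2 ℕ.^ (n ℕ.* p))
        <⟨ ℕ→ℚ-mono-< (ℕ.m<m*n (W ℕ.* 2 ℕ.^ (n ℕ.* p)) (2 ℕ.^ n) {{V≢0}} (ℕ.^-monoʳ-< 2 (s≤s (s≤s z≤n)) 0<n)) ⟩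
      ℕ→ℚ V
        ≡⟨ ℚ.*-identityʳ _ ⟨
      ℕ→ℚ V * 1ℚ
        ≡⟨ cong (ℕ→ℚ V *_) 2^K*½^K ⟨
      ℕ→ℚ V * (ℕ→ℚ (2 ℕ.^ K) * ½ ^ℚ K)
        ≡⟨ ℚ.*-assoc (ℕ→ℚ V) (ℕ→ℚ (2 ℕ.^ K)) (½ ^ℚ K) ⟨
      ℕ→ℚ V * ℕ→ℚ (2 ℕ.^ K) * ½ ^ℚ K
        ≡⟨ cong (_* ½ ^ℚ K) (ℕ→ℚ-* V (2 ℕ.^ K)) ⟨
      ℕ→ℚ (V ℕ.* 2 ℕ.^ K) * ½ ^ℚ K
        ≡⟨ cong (λ k → ℕ→ℚ k * ½ ^ℚ K) split ⟨
      ℕ→ℚ (C ℕ.^ (2 ℕ.* p) ℕ.* (4 ℕ.* p) ℕ.^ (n ℕ.* p)) * ½ ^ℚ K ∎)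
      where
      ½<1 : ½ ℚ.< 1ℚ
      ½<1 = ℚ.*<* (ℤ.+<+ (s≤s (s≤s z≤n)))
      K = n ℕ.* (p ℕ.∸ 1)
      W = C ℕ.^ (2 ℕ.* p) ℕ.* p ℕ.^ (n ℕ.* p)
      V = W ℕ.* 2 ℕ.^ (n ℕ.* p) ℕ.* 2 ℕ.^ n
      V≢0 : NonZero (W ℕ.* 2 ℕ.^ (n ℕ.* p))
      V≢0 = ℕ.m*n≢0 W _ {{ℕ.m*n≢0 _ _ {{ℕ.m^n≢0 C (2 ℕ.* p)}} {{ℕ.m^n≢0 p (n ℕ.* p)}}}} {{ℕ.m^n≢0 2 (n ℕ.* p)}}
      2^K*½^K : ℕ→ℚ (2 ℕ.^ K) * ½ ^ℚ K ≡ 1ℚ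
      2^K*½^K = trans (cong (_* ½ ^ℚ K) (ℕ→ℚ-^ 2 K)) (trans (sym (*-^ℚ (ℕ→ℚ 2) ½ K)) (1^ℚ K))
      np : n ℕ.+ K ≡ n ℕ.* p
      np = trans (sym (ℕ.*-suc n (p ℕ.∸ 1))) (cong (n ℕ.*_) (ℕ.suc-pred p))
      split : C ℕ.^ (2 ℕ.* p) ℕ.* (4 ℕ.* p) ℕ.^ (n ℕ.* p) ≡ V ℕ.* 2 ℕ.^ K
      split = begin
        c ℕ.* (4 ℕ.* p) ℕ.^ (n ℕ.* p)               ≡⟨ cong (c ℕ.*_) (ℕ-*-^ 4 p (n ℕ.* p)) ⟩
        c ℕ.* (4 ℕ.^ (n ℕ.* p) ℕ.* q)               ≡⟨ cong (λ k → c ℕ.* (k ℕ.* q)) (ℕ-*-^ 2 2 (n ℕ.* p)) ⟩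
        c ℕ.* (a ℕ.* a ℕ.* q)
          ≡⟨ cong (λ k → c ℕ.* (a ℕ.* k ℕ.* q)) (trans (cong (2 ℕ.^_) (sym np)) (ℕ.^-distribˡ-+-* 2 n K)) ⟩
        c ℕ.* (a ℕ.* (2 ℕ.^ n ℕ.* 2 ℕ.^ K) ℕ.* q)   ≡⟨ rearrange c a (2 ℕ.^ n) (2 ℕ.^ K) q ⟩
        V ℕ.* 2 ℕ.^ K                               ∎
        where
        open ≡-Reasoning
        c = C ℕ.^ (2 ℕ.* p)
        a = 2 ℕ.^ (n ℕ.* p)
        q = p ℕ.^ (n ℕ.* p)
        rearrange : ∀ c a x y q → c ℕ.* (a ℕ.* (x ℕ.* y) ℕ.* q) ≡ c ℕ.* q ℕ.* a ℕ.* x ℕ.* y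
        rearrange = ℕ-solve-∀
      open ℚ.≤-Reasoning

-- Odd primes, and passing between lists and indexed families.

odd-prime : ∀ {p} → Prime p → 2 < p → p ≡ suc (2 ℕ.* (p ℕ./ 2))
odd-prime {p} p-prime 2<p with p ℕ.% 2 in eq | ℕ.m%n<n p 2
... | 0 | _ with prime⇒irreducible p-prime (ℕ.m%n≡0⇒n∣m p 2 eq)
...   | inj₂ 2≡p = contradiction 2≡p (ℕ.<⇒≢ 2<p)
odd-prime {p} p-prime 2<p | 1 | _ = trans (ℕ.m≡m%n+[m/n]*n p 2) (cong₂ ℕ._+_ eq (ℕ.*-comm (p ℕ./ 2) 2))
odd-prime {p} p-prime 2<p | suc (suc _) | s≤s (s≤s ())

sum-map-toℕ : (f : A → ℕ) (L : List A) → + sum (map f L) ≡ ℤSum.∑ L (λ x → + f x)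
sum-map-toℕ f []      = refl
sum-map-toℕ f (x ∷ L) = trans (ℤ.pos-+ (f x) _) (cong (λ s → + f x ℤ.+ s) (sum-map-toℕ f L))

Unique⇒lookup-injective : {L : List A} → Unique L → ∀ {i j} → List.lookup L i ≡ List.lookup L j → i ≡ j
Unique⇒lookup-injective (x∉ ∷ u) {zero}  {zero}  eq = refl
Unique⇒lookup-injective (x∉ ∷ u) {zero}  {suc j} eq = contradiction eq (All.lookup x∉ (∈-lookup j))
Unique⇒lookup-injective (x∉ ∷ u) {suc i} {zero}  eq = contradiction (sym eq) (All.lookup x∉ (∈-lookup i))
Unique⇒lookup-injective (x∉ ∷ u) {suc i} {suc j} eq = cong suc (Unique⇒lookup-injective u eq)

list⇒family : {L : List A} {k : ℕ} → Unique L → length L ≡ k →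
  ∃ λ (x : Fin k → A) → (∀ {i j} → x i ≡ x j → i ≡ j) × (∀ i → x i ∈ L) × map x (allFin k) ≡ L
list⇒family {L = L} u refl = List.lookup L , Unique⇒lookup-injective u , ∈-lookup ,
  trans (List.map-tabulate (λ i → i) (List.lookup L)) (List.tabulate-lookup L)

module _ (p : ℕ) (p-prime : Prime p) (2<p : 2 < p) (n : ℕ) where
  open ModPrime p p-prime using (P)
  open PopularSums p p-prime 2<p n using (Zero; c)

  -- Indexing `L` by `Fin p` gives an injective family, and its coordinate sums in ℕ agree with the
  -- integer sums in `Zero`.
  no-distinct-list : ∀ {A} → NoDistinctZeroSum p n A →
    ∀ L → Unique L → (∀ {x} → x ∈ L → x ∈ A) → length L ≡ p → ¬ Zero L
  no-distinct-list none L uL L⊆A |L| zL with x , x-injective , x∈L , map-x ← list⇒family uL |L| =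
    none x x-injective (L⊆A ∘ x∈L) λ j →
      ∣⇒∣ᵤ (subst (P ∣_) (sym (begin
        + sum (map (λ i → toℕ (lookup (x i) j)) (allFin p))   ≡⟨ sum-map-toℕ (λ i → toℕ (lookup (x i) j)) (allFin p) ⟩
        ℤSum.∑ (allFin p) (λ i → c j (x i))                   ≡⟨ ℤSum.∑-map x (allFin p) (c j) ⟨
        ℤSum.∑ (map x (allFin p)) (c j)                       ≡⟨ cong (λ K → ℤSum.∑ K (c j)) map-x ⟩
        ℤSum.∑ L (c j)                                        ∎)) (zL j))
    where open ≡-Reasoning

theorem1p1 : (p : ℕ) → Prime p → 5 ≤ p →
    Σ ℕ λ C → (n : ℕ) → 0 < n → (A : List (Vec (Fin p) n)) → Unique A →
    NoDistinctZeroSum p n A →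
    BoundSqrtGammaP p C n (length A) × SqrtGammaP<2SqrtP p C n
theorem1p1 p p-prime 5≤p = constant , λ n 0<n A uA none →
  RationalBounds.bound-γ p p-prime n constant (length A)
    (SizeBound.size-bound p p-prime 2<p n (p ℕ./ 2) (odd-prime p-prime 2<p) A uA (no-distinct-list p p-prime 2<p n none)) ,
  RationalBounds.γ<4 p p-prime n constant 0<n
  where
  2<p : 2 < p
  2<p = ℕ.≤-trans (s≤s (s≤s (s≤s z≤n))) 5≤p
  constant : ℕ
  -- The factor in `size-bound`, with `h` equal to `p / 2` and `r` written out.
  constant = 8 ℕ.* (1 ℕ.+ 4 ℕ.* (p ℕ./ 2)) ℕ.* (1 ℕ.+ 4 ℕ.* (2 ℕ.* p ℕ.+ 2))
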